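{- Let $m\ge 1$ and let $\tau=m\tau'(m+1)\in[m+1]^l$ be a subword pattern, where the word $\tau'$ (of length $l-2$) contains neither the letter $m$ nor the letter $m+1$. Then for every $k\ge m$, \[ F_\tau(x,y;k)=\frac{1}{1-(m-1)x-x\sum_{i=m-2}^{k-2}\prod_{j=m-2}^{i}\Bigl(1-\binom{j}{m-1}x^{l-1}(1-y)\Bigr)}. \]
   Context: $[k]=\{1,\dots,k\}$ and $[k]^n$ is the set of words of length $n$ over $[k]$. A subword pattern is a word $\tau\in[p]^l$ containing every letter of $[p]$. An occurrence of $\tau$ in $\sigma=\sigma_1\cdots\sigma_n$ is an index $i$ such that the consecutive factor $\sigma_i\cdots\sigma_{i+l-1}$ is order-isomorphic to $\tau$ (same relative order and same equalities among positions). $\sigma(\tau)$ is the number of occurrences, and $F_\tau(x,y;k)=\sum_{n\ge0}\sum_{\sigma\in[k]^n}x^ny^{\sigma(\tau)}$. Binomial coefficients $\binom{j}{m-1}$ are $0$ when $0\le j<m-1$.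
   Formalization: For m=1 the product begins at j=-1, where binom(-1,0) must be read as 0 (with the usual value 1 the formula fails, e.g. for the pattern 12 and k=1); the formal statement takes binomial coefficients with negative top to be 0. -}

module Defs where

open import Data.Bool using (Bool; true; false; _∧_; if_then_else_)
open import Data.Nat as ℕ using (ℕ; zero; suc; _∸_; _<ᵇ_; _≡ᵇ_)
open import Data.Nat.Combinatorics using (_C_)
open import Data.Integer as ℤ using (ℤ; +_; -[1+_])
open import Data.List using (List; []; _∷_; map; concatMap; length; filter; take; upTo)
open import Data.List.Membership.Propositional using (_∈_)
open import Data.Product using (_×_; _,_)
open import Relation.Nullary.Decidable using (does)
open import Relation.Binary.PropositionalEquality using (_≡_)

letters : ℕ → List ℕ
letters k = map suc (upTo k)

words : ℕ → ℕ → List (List ℕ)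
words k zero    = [] ∷ []
words k (suc n) = concatMap (λ a → map (a ∷_) (words k n)) (letters k)

IsSubwordPattern : ℕ → ℕ → List ℕ → Set
IsSubwordPattern p l τ =
  (length τ ≡ l) × ((a : ℕ) → a ∈ τ → (1 ℕ.≤ a) × (a ℕ.≤ p))
                 × ((a : ℕ) → 1 ℕ.≤ a → a ℕ.≤ p → a ∈ τ)

_==_ : Bool → Bool → Bool
true  == b = b
false == true  = false
false == false = true

sameRel : ℕ × ℕ → ℕ × ℕ → Bool
sameRel (a , c) (b , d) = ((a <ᵇ b) == (c <ᵇ d)) ∧ ((a ≡ᵇ b) == (c ≡ᵇ d))

zipL : List ℕ → List ℕ → List (ℕ × ℕ)
zipL (a ∷ u) (c ∷ v) = (a , c) ∷ zipL u v
zipL _ _ = []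

allB : {A : Set} → (A → Bool) → List A → Bool
allB p []      = true
allB p (x ∷ xs) = p x ∧ allB p xs

orderIso : List ℕ → List ℕ → Bool
orderIso u v = (length u ≡ᵇ length v) ∧
  allB (λ p → allB (λ q → sameRel p q) (zipL u v)) (zipL u v)

occ : List ℕ → List ℕ → ℕ
occ τ []      = 0
occ τ (a ∷ σ) = (if orderIso (take (length τ) (a ∷ σ)) τ then 1 else 0) ℕ.+ occ τ σ

countOcc : List ℕ → ℕ → ℕ → ℕ → ℕ
countOcc τ k n s = length (filter (λ σ → occ τ σ ℕ.≟ s) (words k n))

-- Formal power series in x, y with integer coefficients:
-- f n s = coefficient of x^n y^s.

PS : Set
PS = ℕ → ℕ → ℤ

Σ< : ℕ → (ℕ → ℤ) → ℤ
Σ< zero    f = + 0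
Σ< (suc n) f = Σ< n f ℤ.+ f n

isZero : ℕ → Bool
isZero zero    = true
isZero (suc _) = false

isOne : ℕ → Bool
isOne (suc zero) = true
isOne _          = false

constPS : ℤ → PS
constPS c n s = if isZero n ∧ isZero s then c else + 0

X : PS
X n s = if isOne n ∧ isZero s then + 1 else + 0

Y : PS
Y n s = if isZero n ∧ isOne s then + 1 else + 0

infixl 6 _⊕_ _⊖_
infixl 7 _⊗_

_⊕_ : PS → PS → PS
(f ⊕ g) n s = f n s ℤ.+ g n s

_⊖_ : PS → PS → PS
(f ⊖ g) n s = f n s ℤ.- g n s

_⊗_ : PS → PS → PS
(f ⊗ g) n s = Σ< (suc n) (λ a → Σ< (suc s) (λ b → f a b ℤ.* g (n ∸ a) (s ∸ b)))

powPS : PS → ℕ → PS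
powPS f zero    = constPS (+ 1)
powPS f (suc e) = f ⊗ powPS f e

sumPS : ℕ → (ℕ → PS) → PS
sumPS zero    F = constPS (+ 0)
sumPS (suc n) F = sumPS n F ⊕ F n

prodPS : ℕ → (ℕ → PS) → PS
prodPS zero    F = constPS (+ 1)
prodPS (suc n) F = prodPS n F ⊗ F n

-- Binomial coefficient with an integer top entry: C(j, r) = 0 for j < 0
-- (and the usual ℕ binomial, which is 0 for 0 ≤ j < r).
binomZ : ℤ → ℕ → ℕ
binomZ (+ j)    r = j C r
binomZ -[1+ _ ] r = 0

Fτ : List ℕ → ℕ → PS
Fτ τ k n s = + countOcc τ k n s

shiftZ : ℕ → ℕ → ℤ
shiftZ m t = (+ t ℤ.+ + m) ℤ.- + 2

-- Denominator
-- 1 - (m-1)x - x Σ_{i=m-2}^{k-2} Π_{j=m-2}^{i} (1 - C(j,m-1) x^{l-1} (1-y)),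
-- with i = m-2+u (0 ≤ u ≤ k-m) and j = m-2+t (0 ≤ t ≤ u).
denom : ℕ → ℕ → ℕ → PS
denom m l k =
  constPS (+ 1) ⊖ constPS (+ (m ∸ 1)) ⊗ X
  ⊖ X ⊗ sumPS (suc (k ∸ m)) (λ u →
          prodPS (suc u) (λ t →
            constPS (+ 1) ⊖ constPS (+ binomZ (shiftZ m t) (m ∸ 1))
                               ⊗ powPS X (l ∸ 1) ⊗ (constPS (+ 1) ⊖ Y)))

onePS : PS
onePS = constPS (+ 1)

{-# OPTIONS --safe #-}
module Submission where

-- Let G_a be the generating function of the words a σ, with x marking the length of σ
-- only, and T_a the sum of G_b over the letters b > a. In an occurrence a u b of
-- τ = m τ′ (m+1) every letter of u is smaller than a and a < b, so no other occurrence
-- starts inside u. Writing y^[a σ starts with an occurrence] = 1 - (1 - y)[...] gives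
--   G_a = F - C(a-1, m-1) x^(l-1) (1 - y) T_a,
-- the binomial coefficient counting the words u below a that are order-isomorphic to τ′.
-- Hence T_(a-1) = F + q_(a-1) T_a with q_j = 1 - C(j, m-1) x^(l-1) (1 - y), and since T_k = 0,
--   T_0 = F Σ_(b<k) Π_(j<b) q_j,
-- which together with F = 1 + x T_0 is the theorem.

open import Defs
open import Level using (0ℓ)
open import Algebra.Bundles using (CommutativeRing; RawRing)
open import Algebra.Morphism.Structures using (IsRingMonomorphism)
import Algebra.Morphism.RingMonomorphism as RingMonomorphism
import Algebra.Properties.CommutativeSemigroup as CommutativeSemigroupProperties
import Algebra.Properties.Ring as RingProperties
open import Data.Bool using (Bool; true; false; T; if_then_else_; _∧_)
open import Data.Bool.Properties using (T-∧; T?)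
open import Data.Empty using (⊥-elim)
open import Data.Integer as ℤ using (ℤ; +_)
import Data.Integer.Properties as ℤ
open import Data.Integer.Tactic.RingSolver using () renaming (solve-∀ to ℤ-solve-∀)
open import Data.List using (List; []; _∷_; _++_; length; take; map; filter; concatMap; cartesianProductWith; upTo; applyUpTo)
import Data.List.Properties as List
open import Data.List.Membership.Propositional using (_∈_; _∉_)
open import Data.List.Membership.Propositional.Properties using (∈-++⁻; ∈-++⁺ˡ; ∈-++⁺ʳ; ∈-map⁺; ∈-map⁻; ∈-∃++; ∈-filter⁺; ∈-filter⁻; ∈-upTo⁺; ∈-upTo⁻; ∈-cartesianProductWith⁺; ∈-cartesianProductWith⁻)
import Data.List.Relation.Unary.All as All
open import Data.List.Relation.Unary.AllPairs using ([]; _∷_)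
open import Data.List.Relation.Unary.Any using (here; there)
open import Data.List.Relation.Unary.Unique.Propositional using (Unique)
import Data.List.Relation.Unary.Unique.Propositional.Properties as Unique
open import Data.Nat as ℕ using (ℕ; zero; suc; _∸_; _≤_; _<_; z≤n; s≤s; _<ᵇ_; _≡ᵇ_)
open import Data.Nat.Combinatorics using (_C_; k>n⇒nCk≡0; nCk+nC[k+1]≡[n+1]C[k+1])
import Data.Nat.Properties as ℕ
open import Data.Product using (_×_; _,_; proj₁; proj₂; ∃-syntax)
open import Data.Sum using (inj₁; inj₂; [_,_]′)
open import Data.Unit using (tt)
open import Function using (_∘_; id)
open import Function.Bundles using (Equivalence)
open import Relation.Binary using (tri<; tri≈; tri>)
open import Relation.Binary.PropositionalEquality using (_≡_; _≢_; refl; sym; trans; cong; cong₂; subst; module ≡-Reasoning)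
import Relation.Binary.Reasoning.Setoid as SetoidReasoning
open import Relation.Nullary using (¬_; yes; no)
open import Relation.Nullary.Decidable using (does)
open import Relation.Unary using (Pred; Decidable)

-- The ring of formal power series

module Series (R : CommutativeRing 0ℓ 0ℓ) where
  open CommutativeRing R renaming (refl to ≈-refl; sym to ≈-sym; trans to ≈-trans)
  open CommutativeSemigroupProperties +-commutativeSemigroup using () renaming (interchange to +-interchange)
  open SetoidReasoning setoid

  infix  4 _≋_
  infixl 7 _⋆_
  infixl 6 _⊞_

  _≋_ : (f g : ℕ → Carrier) → Set
  f ≋ g = ∀ n → f n ≈ g n

  _⊞_ : (f g : ℕ → Carrier) → ℕ → Carrier
  (f ⊞ g) n = f n + g n

  -- The Cauchy product by recursion on the head of `f`: if f = f 0 + x f′, then f g = f 0 g + x (f′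
  -- g). This form turns each ring law into an induction without index arithmetic.
  _⋆_ : (f g : ℕ → Carrier) → ℕ → Carrier
  (f ⋆ g) zero    = f 0 * g 0
  (f ⋆ g) (suc n) = f 0 * g (suc n) + (f ∘ suc ⋆ g) n

  constant : Carrier → ℕ → Carrier
  constant c zero    = c
  constant c (suc _) = 0#

  ⋆-cong : ∀ {f f′ g g′} → f ≋ f′ → g ≋ g′ → f ⋆ g ≋ f′ ⋆ g′
  ⋆-cong p q zero    = *-cong (p 0) (q 0)
  ⋆-cong p q (suc n) = +-cong (*-cong (p 0) (q (suc n))) (⋆-cong (p ∘ suc) q n)

  ⋆-distribʳ : ∀ h f g → (f ⊞ g) ⋆ h ≋ f ⋆ h ⊞ g ⋆ h
  ⋆-distribʳ h f g zero    = distribʳ (h 0) (f 0) (g 0)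
  ⋆-distribʳ h f g (suc n) = begin
    (f 0 + g 0) * h (suc n) + ((f ∘ suc ⊞ g ∘ suc) ⋆ h) n
      ≈⟨ +-cong (distribʳ _ _ _) (⋆-distribʳ h (f ∘ suc) (g ∘ suc) n) ⟩
    (f 0 * h (suc n) + g 0 * h (suc n)) + ((f ∘ suc ⋆ h) n + (g ∘ suc ⋆ h) n)
      ≈⟨ +-interchange _ _ _ _ ⟩
    (f ⋆ h ⊞ g ⋆ h) (suc n) ∎

  ⋆-scalar : ∀ c f g → (λ n → c * f n) ⋆ g ≋ λ n → c * (f ⋆ g) n
  ⋆-scalar c f g zero    = *-assoc _ _ _
  ⋆-scalar c f g (suc n) = begin
    c * f 0 * g (suc n) + ((λ n → c * f (suc n)) ⋆ g) n
      ≈⟨ +-cong (*-assoc _ _ _) (⋆-scalar c (f ∘ suc) g n) ⟩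
    c * (f 0 * g (suc n)) + c * (f ∘ suc ⋆ g) n
      ≈⟨ distribˡ _ _ _ ⟨
    c * (f ⋆ g) (suc n) ∎

  -- The tail of `f ⋆ g` is a scalar multiple of the tail of `g` plus a product with the tail of
  -- `f`, so distributivity and scalar associativity reduce the claim to the tail of `f`.
  ⋆-assoc : ∀ f g h → (f ⋆ g) ⋆ h ≋ f ⋆ (g ⋆ h)
  ⋆-assoc f g h zero    = *-assoc _ _ _
  ⋆-assoc f g h (suc n) = begin
    f 0 * g 0 * h (suc n) + (((λ n → f 0 * g (suc n)) ⊞ f ∘ suc ⋆ g) ⋆ h) n
      ≈⟨ +-cong (*-assoc _ _ _) (⋆-distribʳ h _ (f ∘ suc ⋆ g) n) ⟩
    f 0 * (g 0 * h (suc n)) + (((λ n → f 0 * g (suc n)) ⋆ h) n + ((f ∘ suc ⋆ g) ⋆ h) n)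
      ≈⟨ +-congˡ (+-cong (⋆-scalar (f 0) (g ∘ suc) h n) (⋆-assoc (f ∘ suc) g h n)) ⟩
    f 0 * (g 0 * h (suc n)) + (f 0 * (g ∘ suc ⋆ h) n + (f ∘ suc ⋆ (g ⋆ h)) n)
      ≈⟨ +-assoc _ _ _ ⟨
    f 0 * (g 0 * h (suc n)) + f 0 * (g ∘ suc ⋆ h) n + (f ∘ suc ⋆ (g ⋆ h)) n
      ≈⟨ +-congʳ (distribˡ _ _ _) ⟨
    (f ⋆ (g ⋆ h)) (suc n) ∎

  -- The mirror image of the defining recursion, with the head of `g` split off; comparing the two
  -- recursions yields commutativity.
  ⋆-sucʳ : ∀ f g n → (f ⋆ g) (suc n) ≈ f (suc n) * g 0 + (f ⋆ g ∘ suc) n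
  ⋆-sucʳ f g zero    = +-comm _ _
  ⋆-sucʳ f g (suc n) = begin
    f 0 * g (suc (suc n)) + (f ∘ suc ⋆ g) (suc n)
      ≈⟨ +-congˡ (⋆-sucʳ (f ∘ suc) g n) ⟩
    f 0 * g (suc (suc n)) + (f (suc (suc n)) * g 0 + (f ∘ suc ⋆ g ∘ suc) n)
      ≈⟨ x∙yz≈y∙xz _ _ _ ⟩
    f (suc (suc n)) * g 0 + (f ⋆ g ∘ suc) (suc n) ∎
    where open CommutativeSemigroupProperties +-commutativeSemigroup using (x∙yz≈y∙xz)

  ⋆-comm : ∀ f g → f ⋆ g ≋ g ⋆ f
  ⋆-comm f g zero    = *-comm _ _
  ⋆-comm f g (suc n) = begin
    f 0 * g (suc n) + (f ∘ suc ⋆ g) n ≈⟨ +-cong (*-comm _ _) (⋆-comm (f ∘ suc) g n) ⟩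
    g (suc n) * f 0 + (g ⋆ f ∘ suc) n ≈⟨ ⋆-sucʳ g f n ⟨
    (g ⋆ f) (suc n)                   ∎

  ⋆-zeroˡ : ∀ f → (λ _ → 0#) ⋆ f ≋ λ _ → 0#
  ⋆-zeroˡ f zero    = zeroˡ _
  ⋆-zeroˡ f (suc n) = ≈-trans (+-cong (zeroˡ _) (⋆-zeroˡ f n)) (+-identityˡ 0#)

  constant-⋆ : ∀ c f → constant c ⋆ f ≋ λ n → c * f n
  constant-⋆ c f zero    = ≈-refl
  constant-⋆ c f (suc n) = ≈-trans (+-congˡ (⋆-zeroˡ f n)) (+-identityʳ _)

  ⋆-identityˡ : ∀ f → constant 1# ⋆ f ≋ f
  ⋆-identityˡ f n = ≈-trans (constant-⋆ 1# f n) (*-identityˡ _)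

  seriesRing : CommutativeRing 0ℓ 0ℓ
  seriesRing = record
    { Carrier = ℕ → Carrier
    ; _≈_ = _≋_
    ; _+_ = _⊞_
    ; _*_ = _⋆_
    ; -_  = λ f n → - f n
    ; 0#  = λ _ → 0#
    ; 1#  = constant 1#
    ; isCommutativeRing = record
      { isRing = record
        { +-isAbelianGroup = record
          { isGroup = record
            { isMonoid = record
              { isSemigroup = record
                { isMagma = record
                  { isEquivalence = record
                    { refl  = λ n → ≈-refl
                    ; sym   = λ p n → ≈-sym (p n)
                    ; trans = λ p q n → ≈-trans (p n) (q n)
                    }
                  ; ∙-cong = λ p q n → +-cong (p n) (q n)
                  }
                ; assoc = λ f g h n → +-assoc _ _ _
                }
              ; identity = (λ f n → +-identityˡ _) , (λ f n → +-identityʳ _)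
              }
            ; inverse = (λ f n → -‿inverseˡ _) , (λ f n → -‿inverseʳ _)
            ; ⁻¹-cong = λ p n → -‿cong (p n)
            }
          ; comm = λ f g n → +-comm _ _
          }
        ; *-cong = ⋆-cong
        ; *-assoc = ⋆-assoc
        ; *-identity = ⋆-identityˡ , λ f n → ≈-trans (⋆-comm f _ n) (⋆-identityˡ f n)
        ; distrib = (λ f g h n → ≈-trans (⋆-comm f _ n)
                       (≈-trans (⋆-distribʳ f g h n) (+-cong (⋆-comm g f n) (⋆-comm h f n))))
                  , ⋆-distribʳ
        }
      ; *-comm = ⋆-comm
      }
    }

-- Double series as series in x over the ring of series in y

module Inner = Series ℤ.+-*-commutativeRing
module Outer = Series Inner.seriesRing

infix 4 _≈_

_≈_ : PS → PS → Set
f ≈ g = ∀ n s → f n s ≡ g n s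

Σ<-cong : ∀ n {f g : ℕ → ℤ} → (∀ i → f i ≡ g i) → Σ< n f ≡ Σ< n g
Σ<-cong zero    p = refl
Σ<-cong (suc n) p = cong₂ ℤ._+_ (Σ<-cong n p) (p n)

Σ<-front : ∀ n f → Σ< (suc n) f ≡ f 0 ℤ.+ Σ< n (f ∘ suc)
Σ<-front zero    f = ℤ.+-comm (+ 0) (f 0)
Σ<-front (suc n) f = trans (cong (ℤ._+ f (suc n)) (Σ<-front n f)) (ℤ.+-assoc (f 0) _ _)

Σ<≡⋆ : ∀ f g s → Σ< (suc s) (λ b → f b ℤ.* g (s ∸ b)) ≡ (f Inner.⋆ g) s
Σ<≡⋆ f g zero    = ℤ.+-identityˡ _
Σ<≡⋆ f g (suc s) = trans (Σ<-front (suc s) (λ b → f b ℤ.* g (suc s ∸ b)))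
  (cong (ℤ._+_ (f 0 ℤ.* g (suc s))) (Σ<≡⋆ (f ∘ suc) g s))

⊗≈⋆ : ∀ f g → f ⊗ g ≈ f Outer.⋆ g
⊗≈⋆ f g n s = trans (Σ<-cong (suc n) (λ a → Σ<≡⋆ (f a) (g (n ∸ a)) s)) (outer f n)
  where
  outer : ∀ f n → Σ< (suc n) (λ a → (f a Inner.⋆ g (n ∸ a)) s) ≡ (f Outer.⋆ g) n s
  outer f zero    = ℤ.+-identityˡ _
  outer f (suc n) = trans (Σ<-front (suc n) (λ a → (f a Inner.⋆ g (suc n ∸ a)) s))
    (cong (ℤ._+_ ((f 0 Inner.⋆ g (suc n)) s)) (outer (f ∘ suc) n))

constPS≈constant : ∀ c → constPS c ≈ Outer.constant (Inner.constant c)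
constPS≈constant c zero    zero    = refl
constPS≈constant c zero    (suc s) = refl
constPS≈constant c (suc n) s       = refl

constPS-0 : constPS (+ 0) ≈ λ _ _ → + 0
constPS-0 zero    zero    = refl
constPS-0 zero    (suc s) = refl
constPS-0 (suc n) s       = refl

psRawRing : RawRing 0ℓ 0ℓ
psRawRing = record
  { Carrier = PS
  ; _≈_ = _≈_
  ; _+_ = _⊕_
  ; _*_ = _⊗_
  ; -_  = λ f n s → ℤ.- f n s
  ; 0#  = constPS (+ 0)
  ; 1#  = constPS (+ 1)
  }

-- The operations on `PS` agree coefficientwise with those of the iterated series ring, so the
-- identity carries all ring laws back to the double sums of `_⊗_`.
id-isRingMonomorphism : IsRingMonomorphism psRawRing (CommutativeRing.rawRing Outer.seriesRing) id
id-isRingMonomorphism = record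
  { isRingHomomorphism = record
    { isSemiringHomomorphism = record
      { isNearSemiringHomomorphism = record
        { +-isMonoidHomomorphism = record
          { isMagmaHomomorphism = record
            { isRelHomomorphism = record { cong = id }
            ; homo = λ f g n s → refl
            }
          ; ε-homo = constPS-0
          }
        ; *-homo = ⊗≈⋆
        }
      ; 1#-homo = constPS≈constant (+ 1)
      }
    ; -‿homo = λ f n s → refl
    }
  ; injective = id
  }

psRing : CommutativeRing 0ℓ 0ℓ
psRing = record
  { isCommutativeRing = RingMonomorphism.isCommutativeRing id-isRingMonomorphism
      (CommutativeRing.isCommutativeRing Outer.seriesRing) }

constPS-⊗ : ∀ c f n s → (constPS c ⊗ f) n s ≡ c ℤ.* f n s
constPS-⊗ c f n s = begin
  (constPS c ⊗ f) n s                            ≡⟨ ⊗≈⋆ (constPS c) f n s ⟩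
  (constPS c Outer.⋆ f) n s                      ≡⟨ Outer.⋆-cong {g = f} (constPS≈constant c) (λ _ _ → refl) n s ⟩
  (Outer.constant (Inner.constant c) Outer.⋆ f) n s ≡⟨ Outer.constant-⋆ (Inner.constant c) f n s ⟩
  (Inner.constant c Inner.⋆ f n) s               ≡⟨ Inner.constant-⋆ c (f n) s ⟩
  c ℤ.* f n s                                    ∎
  where open ≡-Reasoning

X-⊗-zero : ∀ f s → (X ⊗ f) 0 s ≡ + 0
X-⊗-zero f s = trans (⊗≈⋆ X f 0 s) (Inner.⋆-zeroˡ (f 0) s)

X-⊗-suc : ∀ f n s → (X ⊗ f) (suc n) s ≡ f n s
X-⊗-suc f n s = begin
  (X ⊗ f) (suc n) s                                     ≡⟨ ⊗≈⋆ X f (suc n) s ⟩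
  (X 0 Inner.⋆ f (suc n)) s ℤ.+ (X ∘ suc Outer.⋆ f) n s ≡⟨ cong₂ ℤ._+_ (Inner.⋆-zeroˡ (f (suc n)) s)
                                                            (Outer.⋆-cong {g = f} X-tail (λ _ _ → refl) n s) ⟩
  + 0 ℤ.+ (Outer.constant (Inner.constant (+ 1)) Outer.⋆ f) n s
    ≡⟨ ℤ.+-identityˡ _ ⟩
  (Outer.constant (Inner.constant (+ 1)) Outer.⋆ f) n s ≡⟨ Outer.⋆-identityˡ f n s ⟩
  f n s                                                 ∎
  where
  open ≡-Reasoning
  X-tail : X ∘ suc ≈ Outer.constant (Inner.constant (+ 1))
  X-tail zero    zero    = refl
  X-tail zero    (suc s) = refl
  X-tail (suc n) s       = refl

Y-⊗ : ∀ f n s → (Y ⊗ f) n s ≡ (Y 0 Inner.⋆ f n) s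
Y-⊗ f n s = begin
  (Y ⊗ f) n s                     ≡⟨ ⊗≈⋆ Y f n s ⟩
  (Y Outer.⋆ f) n s               ≡⟨ Outer.⋆-cong {g = f} Y-constant (λ _ _ → refl) n s ⟩
  (Outer.constant (Y 0) Outer.⋆ f) n s ≡⟨ Outer.constant-⋆ (Y 0) f n s ⟩
  (Y 0 Inner.⋆ f n) s             ∎
  where
  open ≡-Reasoning
  Y-constant : Y ≈ Outer.constant (Y 0)
  Y-constant zero    s = refl
  Y-constant (suc n) s = refl

Y-⊗-zero : ∀ f n → (Y ⊗ f) n 0 ≡ + 0
Y-⊗-zero f n = Y-⊗ f n 0

Y-⊗-suc : ∀ f n s → (Y ⊗ f) n (suc s) ≡ f n s
Y-⊗-suc f n s = begin
  (Y ⊗ f) n (suc s)                          ≡⟨ Y-⊗ f n (suc s) ⟩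
  + 0 ℤ.+ (Y 0 ∘ suc Inner.⋆ f n) s          ≡⟨ ℤ.+-identityˡ _ ⟩
  (Y 0 ∘ suc Inner.⋆ f n) s                  ≡⟨ Inner.⋆-cong {g = f n} Y-tail (λ _ → refl) s ⟩
  (Inner.constant (+ 1) Inner.⋆ f n) s       ≡⟨ Inner.⋆-identityˡ (f n) s ⟩
  f n s                                      ∎
  where
  open ≡-Reasoning
  Y-tail : ∀ s → Y 0 (suc s) ≡ Inner.constant (+ 1) s
  Y-tail zero    = refl
  Y-tail (suc s) = refl

powX-⊗-+ : ∀ e f n s → (powPS X e ⊗ f) (e ℕ.+ n) s ≡ f n s
powX-⊗-+ zero    f n s = CommutativeRing.*-identityˡ psRing f n s
powX-⊗-+ (suc e) f n s = begin
  (X ⊗ powPS X e ⊗ f) (suc e ℕ.+ n) s   ≡⟨ CommutativeRing.*-assoc psRing X (powPS X e) f (suc e ℕ.+ n) s ⟩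
  (X ⊗ (powPS X e ⊗ f)) (suc e ℕ.+ n) s ≡⟨ X-⊗-suc (powPS X e ⊗ f) (e ℕ.+ n) s ⟩
  (powPS X e ⊗ f) (e ℕ.+ n) s           ≡⟨ powX-⊗-+ e f n s ⟩
  f n s                                 ∎
  where open ≡-Reasoning

powX-⊗-< : ∀ e f {n} s → n < e → (powPS X e ⊗ f) n s ≡ + 0
powX-⊗-< (suc e) f {zero} s _ =
  trans (CommutativeRing.*-assoc psRing X (powPS X e) f 0 s) (X-⊗-zero (powPS X e ⊗ f) s)
powX-⊗-< (suc e) f {suc n} s (s≤s n<e) =
  trans (CommutativeRing.*-assoc psRing X (powPS X e) f (suc n) s)
    (trans (X-⊗-suc (powPS X e ⊗ f) n s) (powX-⊗-< e f s n<e))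

-- Order-isomorphism and occurrences of the pattern

T-ext : ∀ {x y} → (T x → T y) → (T y → T x) → x ≡ y
T-ext {true}  {true}  f g = refl
T-ext {true}  {false} f g = ⊥-elim (f tt)
T-ext {false} {true}  f g = ⊥-elim (g tt)
T-ext {false} {false} f g = refl

T⇒≡true : ∀ {x} → T x → x ≡ true
T⇒≡true t = T-ext (λ _ → tt) (λ _ → t)

¬T⇒≡false : ∀ {x} → ¬ T x → x ≡ false
¬T⇒≡false ¬x = T-ext ¬x (λ ())

∧⁻ : ∀ {x y} → T (x ∧ y) → T x × T y
∧⁻ = Equivalence.to T-∧

∧⁺ : ∀ {x y} → T x → T y → T (x ∧ y)
∧⁺ p q = Equivalence.from T-∧ (p , q)

==⁻ : ∀ {x y} → T (x == y) → T y → T x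
==⁻ {true}          _ _ = tt
==⁻ {false} {false} _ q = q

==⁺ : ∀ {x y} → (T x → T y) → (T y → T x) → T (x == y)
==⁺ {true}          f g = f tt
==⁺ {false} {true}  f g = g tt
==⁺ {false} {false} f g = tt

allB⁻ : ∀ {A : Set} {p : A → Bool} {x xs} → T (allB p xs) → x ∈ xs → T (p x)
allB⁻ t (here refl) = proj₁ (∧⁻ t)
allB⁻ t (there i)   = allB⁻ (proj₂ (∧⁻ t)) i

allB⁺ : ∀ {A : Set} {p : A → Bool} xs → (∀ {x} → x ∈ xs → T (p x)) → T (allB p xs)
allB⁺ []       f = tt
allB⁺ (x ∷ xs) f = ∧⁺ (f (here refl)) (allB⁺ xs (f ∘ there))

sameRel-< : ∀ {a b c d} → T (sameRel (a , c) (b , d)) → c < d → a < b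
sameRel-< {a} {b} t c<d = ℕ.<ᵇ⇒< a b (==⁻ (proj₁ (∧⁻ t)) (ℕ.<⇒<ᵇ c<d))

sameRel-≡ : ∀ {a b c d} → T (sameRel (a , c) (b , d)) → c ≡ d → a ≡ b
sameRel-≡ {a} {b} {c} {d} t c≡d = ℕ.≡ᵇ⇒≡ a b (==⁻ (proj₂ (∧⁻ {(a <ᵇ b) == (c <ᵇ d)} t)) (ℕ.≡⇒≡ᵇ c d c≡d))

sameRel⁺ : ∀ {a b c d} → (a < b → c < d) → (c < d → a < b) →
           (a ≡ b → c ≡ d) → (c ≡ d → a ≡ b) → T (sameRel (a , c) (b , d))
sameRel⁺ {a} {b} {c} {d} f g h i = ∧⁺
  (==⁺ (ℕ.<⇒<ᵇ ∘ f ∘ ℕ.<ᵇ⇒< a b) (ℕ.<⇒<ᵇ ∘ g ∘ ℕ.<ᵇ⇒< c d))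
  (==⁺ (ℕ.≡⇒≡ᵇ c d ∘ h ∘ ℕ.≡ᵇ⇒≡ a b) (ℕ.≡⇒≡ᵇ a b ∘ i ∘ ℕ.≡ᵇ⇒≡ c d))

sameRel-both-< : ∀ {a b c d} → a < b → c < d → T (sameRel (a , c) (b , d))
sameRel-both-< p q = sameRel⁺ (λ _ → q) (λ _ → p) (⊥-elim ∘ ℕ.<⇒≢ p) (⊥-elim ∘ ℕ.<⇒≢ q)

sameRel-both-> : ∀ {a b c d} → b < a → d < c → T (sameRel (a , c) (b , d))
sameRel-both-> p q = sameRel⁺ (⊥-elim ∘ ℕ.<-asym p) (⊥-elim ∘ ℕ.<-asym q)
  (⊥-elim ∘ ℕ.>⇒≢ p) (⊥-elim ∘ ℕ.>⇒≢ q)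

sameRel-refl : ∀ {a c} → T (sameRel (a , c) (a , c))
sameRel-refl {a} {c} = sameRel⁺ {a} {a} {c} {c} (⊥-elim ∘ ℕ.<-irrefl refl) (⊥-elim ∘ ℕ.<-irrefl refl) (λ _ → refl) (λ _ → refl)

orderIso-length : ∀ {u v} → T (orderIso u v) → length u ≡ length v
orderIso-length {u} {v} t = ℕ.≡ᵇ⇒≡ (length u) (length v) (proj₁ (∧⁻ t))

orderIso⁻ : ∀ {u v p q} → T (orderIso u v) → p ∈ zipL u v → q ∈ zipL u v → T (sameRel p q)
orderIso⁻ {u} {v} t i j = allB⁻ (allB⁻ (proj₂ (∧⁻ {length u ≡ᵇ length v} t)) i) j

orderIso⁺ : ∀ {u v} → length u ≡ length v →
            (∀ {p q} → p ∈ zipL u v → q ∈ zipL u v → T (sameRel p q)) → T (orderIso u v)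
orderIso⁺ {u} {v} e f =
  ∧⁺ (ℕ.≡⇒≡ᵇ (length u) (length v) e) (allB⁺ _ λ i → allB⁺ _ λ j → f i j)

∈-zipL⁻ : ∀ {u v x c} → (x , c) ∈ zipL u v → x ∈ u × c ∈ v
∈-zipL⁻ {_ ∷ _} {_ ∷ _} (here refl) = here refl , here refl
∈-zipL⁻ {_ ∷ _} {_ ∷ _} (there i)   = let p , q = ∈-zipL⁻ i in there p , there q

∈-zipL⁺ˡ : ∀ {u v x} → length u ≡ length v → x ∈ u → ∃[ c ] (x , c) ∈ zipL u v
∈-zipL⁺ˡ {_ ∷ _} {c ∷ _} e (here refl) = c , here refl
∈-zipL⁺ˡ {_ ∷ _} {_ ∷ _} e (there i)   = let c , j = ∈-zipL⁺ˡ (ℕ.suc-injective e) i in c , there j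

∈-zipL⁺ʳ : ∀ {u v c} → length u ≡ length v → c ∈ v → ∃[ x ] (x , c) ∈ zipL u v
∈-zipL⁺ʳ {x ∷ _} {_ ∷ _} e (here refl) = x , here refl
∈-zipL⁺ʳ {_ ∷ _} {_ ∷ _} e (there i)   = let x , j = ∈-zipL⁺ʳ (ℕ.suc-injective e) i in x , there j

zipL-++ : ∀ u v {u′ v′} → length u ≡ length v → zipL (u ++ u′) (v ++ v′) ≡ zipL u v ++ zipL u′ v′
zipL-++ []      []      e = refl
zipL-++ (x ∷ u) (c ∷ v) e = cong ((x , c) ∷_) (zipL-++ u v (ℕ.suc-injective e))

take-++-∷ : ∀ (u v : List ℕ) {b ρ c} → length u ≡ length v → take (length (v ++ c ∷ [])) (u ++ b ∷ ρ) ≡ u ++ b ∷ []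
take-++-∷ []      []      e = refl
take-++-∷ (x ∷ u) (c ∷ v) e = cong (x ∷_) (take-++-∷ u v (ℕ.suc-injective e))

-- The letter `b` sits at index `length v`, which falls within `w`. With `w` the interior of the
-- pattern, this places `b` opposite a letter smaller than the first one.
∈-zipL-take : ∀ (v w : List ℕ) {b ρ r} → length v < length w →
              ∃[ c ] c ∈ w × (b , c) ∈ zipL (take (length (w ++ r)) (v ++ b ∷ ρ)) (w ++ r)
∈-zipL-take []      (c ∷ w) _ = c , here refl , here refl
∈-zipL-take (x ∷ v) (_ ∷ w) (s≤s lt) = let c , i , j = ∈-zipL-take v w lt in c , there i , there j

module Pattern (m : ℕ) (τ′ : List ℕ) (τ′<m : ∀ {c} → c ∈ τ′ → c < m) where

  τ : List ℕ
  τ = m ∷ τ′ ++ suc m ∷ []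

  -- The part of the occurrence condition on `a u b` that does not involve `b`; isolating it lets
  -- the sums over `u` and over `b` separate.
  fits : ℕ → List ℕ → Bool
  fits a u = orderIso u τ′ ∧ allB (_<ᵇ a) u

  fits⁻ : ∀ {a u} → T (fits a u) → T (orderIso u τ′) × (∀ {x} → x ∈ u → x < a)
  fits⁻ {a} {u} t = proj₁ (∧⁻ t) , λ {x} i → ℕ.<ᵇ⇒< x a (allB⁻ (proj₂ (∧⁻ {orderIso u τ′} t)) i)

  fits⁺ : ∀ {a u} → T (orderIso u τ′) → (∀ {x} → x ∈ u → x < a) → T (fits a u)
  fits⁺ {u = u} t f = ∧⁺ t (allB⁺ u (ℕ.<⇒<ᵇ ∘ f))

  zipL-τ : ∀ {a b} u → length u ≡ length τ′ →
           zipL (a ∷ u ++ b ∷ []) τ ≡ (a , m) ∷ zipL u τ′ ++ (b , suc m) ∷ []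
  zipL-τ u e = cong (_ ∷_) (zipL-++ u τ′ e)

  data Entry (a b : ℕ) (u : List ℕ) : ℕ × ℕ → Set where
    first : Entry a b u (a , m)
    inner : ∀ {x c} → (x , c) ∈ zipL u τ′ → Entry a b u (x , c)
    last  : Entry a b u (b , suc m)

  entry : ∀ {a b p} u → length u ≡ length τ′ → p ∈ zipL (a ∷ u ++ b ∷ []) τ → Entry a b u p
  entry {p = p} u e i with subst (p ∈_) (zipL-τ u e) i
  ... | here refl = first
  ... | there j with ∈-++⁻ (zipL u τ′) j
  ...   | inj₁ k           = inner k
  ...   | inj₂ (here refl) = last

  -- In both words the interior lies below the first letter and the first letter below the last, so
  -- only pairs of interior letters depend on the isomorphism of `u` with `τ′`.
  orderIso-τ⁺ : ∀ {a b} u → length u ≡ length τ′ → T (orderIso u τ′) →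
                (∀ {x} → x ∈ u → x < a) → a < b → T (orderIso (a ∷ u ++ b ∷ []) τ)
  orderIso-τ⁺ {a} {b} u e iso u<a a<b =
    orderIso⁺ length-eq λ i j → related (entry u e i) (entry u e j)
    where
    length-eq : length (a ∷ u ++ b ∷ []) ≡ length τ
    length-eq = cong suc (trans (List.length-++ u) (trans (cong (ℕ._+ 1) e) (sym (List.length-++ τ′))))
    x<a : ∀ {x c} → (x , c) ∈ zipL u τ′ → x < a
    x<a i = u<a (proj₁ (∈-zipL⁻ i))
    c<m : ∀ {x c} → (x , c) ∈ zipL u τ′ → c < m
    c<m i = τ′<m (proj₂ (∈-zipL⁻ {u} i))
    related : ∀ {p q} → Entry a b u p → Entry a b u q → T (sameRel p q)
    related first     first     = sameRel-refl {a} {m}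
    related first     (inner j) = sameRel-both-> (x<a j) (c<m j)
    related first     last      = sameRel-both-< a<b (ℕ.n<1+n m)
    related (inner i) first     = sameRel-both-< (x<a i) (c<m i)
    related (inner i) (inner j) = orderIso⁻ {u} {τ′} iso i j
    related (inner i) last      = sameRel-both-< (ℕ.<-trans (x<a i) a<b) (ℕ.m<n⇒m<1+n (c<m i))
    related last      first     = sameRel-both-> a<b (ℕ.n<1+n m)
    related last      (inner j) = sameRel-both-> (ℕ.<-trans (x<a j) a<b) (ℕ.m<n⇒m<1+n (c<m j))
    related last      last      = sameRel-refl {b} {suc m}

  -- Each conclusion comes from restricting the comparison to certain positions: two interior ones,
  -- an interior one and the first, the first and the last.
  orderIso-τ⁻ : ∀ {a b} u → length u ≡ length τ′ → T (orderIso (a ∷ u ++ b ∷ []) τ) →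
                T (orderIso u τ′) × (∀ {x} → x ∈ u → x < a) × a < b
  orderIso-τ⁻ {a} {b} u e t =
      orderIso⁺ e (λ i j → related (mid i) (mid j))
    , (λ i → let c , j = ∈-zipL⁺ˡ e i in sameRel-< (related (mid j) fst) (τ′<m (proj₂ (∈-zipL⁻ {u} j))))
    , sameRel-< {a} {b} (related fst lst) (ℕ.n<1+n m)
    where
    Z : List (ℕ × ℕ)
    Z = (a , m) ∷ zipL u τ′ ++ (b , suc m) ∷ []
    related : ∀ {p q} → p ∈ Z → q ∈ Z → T (sameRel p q)
    related {p} {q} i j = orderIso⁻ {a ∷ u ++ b ∷ []} {τ} t
      (subst (p ∈_) (sym (zipL-τ u e)) i) (subst (q ∈_) (sym (zipL-τ u e)) j)
    fst : (a , m) ∈ Z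
    fst = here refl
    mid : ∀ {p} → p ∈ zipL u τ′ → p ∈ Z
    mid i = there (∈-++⁺ˡ i)
    lst : (b , suc m) ∈ Z
    lst = there (∈-++⁺ʳ (zipL u τ′) (here refl))

  orderIso-take-τ : ∀ a b u ρ → length u ≡ length τ′ →
                    orderIso (take (length τ) (a ∷ u ++ b ∷ ρ)) τ ≡ fits a u ∧ (a <ᵇ b)
  orderIso-take-τ a b u ρ e = trans (cong (λ w → orderIso (a ∷ w) τ) (take-++-∷ u τ′ e)) (T-ext
    (λ t → let iso , u<a , a<b = orderIso-τ⁻ {a} {b} u e t in ∧⁺ (fits⁺ iso u<a) (ℕ.<⇒<ᵇ a<b))
    (λ t → let iso , u<a = fits⁻ {a} {u} (proj₁ (∧⁻ t)) in
           orderIso-τ⁺ u e iso u<a (ℕ.<ᵇ⇒< a b (proj₂ (∧⁻ {fits a u} t)))))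

  -- An occurrence starting at a letter x of v would have b among its interior
  -- letters, which are all smaller than x.
  occ-skip : ∀ v b ρ → length v ≤ length τ′ → (∀ {x} → x ∈ v → x < b) →
             occ τ (v ++ b ∷ ρ) ≡ occ τ (b ∷ ρ)
  occ-skip []      b ρ le v<b = refl
  occ-skip (x ∷ v) b ρ le v<b = cong₂ (λ t n → (if t then 1 else 0) ℕ.+ n)
    (¬T⇒≡false not-here) (occ-skip v b ρ (ℕ.<⇒≤ le) (v<b ∘ there))
    where
    not-here : ¬ T (orderIso (take (length τ) (x ∷ v ++ b ∷ ρ)) τ)
    not-here t = let c , c∈τ′ , i = ∈-zipL-take v τ′ le in
      ℕ.<-asym (v<b (here refl))
        (sameRel-< (orderIso⁻ {take (length τ) (x ∷ v ++ b ∷ ρ)} {τ} t (there i) (here refl)) (τ′<m c∈τ′))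

-- Words order-isomorphic to a word with letters exactly 1, ..., p

-- Pigeonhole by deletion: the partner `y` of the head is removed from `ys`, and no later element
-- can need it, since it would then equal the head. Two uses in opposite directions replace a
-- bijection.
length-≤-by-matching : ∀ {A B : Set} (R : A → B → Set) → (∀ {x x′ y} → R x y → R x′ y → x ≡ x′) →
  ∀ {xs ys} → Unique xs → (∀ {x} → x ∈ xs → ∃[ y ] y ∈ ys × R x y) → length xs ≤ length ys
length-≤-by-matching R inj {[]}     _        _ = z≤n
length-≤-by-matching R inj {x ∷ xs} {ys} (x≢ ∷ uniq) match with match (here refl)
... | y , y∈ys , xRy with ∈-∃++ y∈ys
... | ys₁ , ys₂ , refl = begin
  suc (length xs)                ≤⟨ s≤s (length-≤-by-matching R inj uniq match′) ⟩
  suc (length (ys₁ ++ ys₂))      ≡⟨ cong suc (List.length-++ ys₁) ⟩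
  suc (length ys₁ ℕ.+ length ys₂) ≡⟨ ℕ.+-suc (length ys₁) (length ys₂) ⟨
  length ys₁ ℕ.+ suc (length ys₂) ≡⟨ List.length-++ ys₁ ⟨
  length (ys₁ ++ y ∷ ys₂)        ∎
  where
  open ℕ.≤-Reasoning
  match′ : ∀ {x′} → x′ ∈ xs → ∃[ y′ ] y′ ∈ ys₁ ++ ys₂ × R x′ y′
  match′ x′∈xs with match (there x′∈xs)
  ... | y′ , y′∈ , x′Ry′ with ∈-++⁻ ys₁ y′∈
  ... | inj₁ i           = y′ , ∈-++⁺ˡ i , x′Ry′
  ... | inj₂ (there i)   = y′ , ∈-++⁺ʳ ys₁ i , x′Ry′
  ... | inj₂ (here refl) = ⊥-elim (All.lookup x≢ x′∈xs (inj xRy x′Ry′))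

∈-letters⁺ : ∀ {k x} → 1 ≤ x → x ≤ k → x ∈ letters k
∈-letters⁺ {x = suc x} _ x<k = ∈-map⁺ suc (∈-upTo⁺ x<k)

∈-letters⁻ : ∀ {k x} → x ∈ letters k → 1 ≤ x × x ≤ k
∈-letters⁻ i with ∈-map⁻ suc i
... | y , y∈ , refl = s≤s z≤n , ∈-upTo⁻ y∈

concatMap≡cartesianProductWith : ∀ {A B C : Set} (f : A → B → C) xs ys →
  concatMap (λ a → map (f a) ys) xs ≡ cartesianProductWith f xs ys
concatMap≡cartesianProductWith f []       ys = refl
concatMap≡cartesianProductWith f (x ∷ xs) ys = cong (map (f x) ys ++_) (concatMap≡cartesianProductWith f xs ys)

words-suc : ∀ k n → words k (suc n) ≡ cartesianProductWith _∷_ (letters k) (words k n)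
words-suc k n = concatMap≡cartesianProductWith _∷_ (letters k) (words k n)

∈-words⁺ : ∀ {k} u → (∀ {x} → x ∈ u → 1 ≤ x × x ≤ k) → u ∈ words k (length u)
∈-words⁺     []      f = here refl
∈-words⁺ {k} (x ∷ u) f = subst (x ∷ u ∈_) (sym (words-suc k (length u)))
  (∈-cartesianProductWith⁺ _∷_ (∈-letters⁺ (proj₁ (f (here refl))) (proj₂ (f (here refl)))) (∈-words⁺ u (f ∘ there)))

∈-words⁻ : ∀ {k} n {u} → u ∈ words k n → length u ≡ n × (∀ {x} → x ∈ u → 1 ≤ x × x ≤ k)
∈-words⁻     zero    (here refl) = refl , λ ()
∈-words⁻ {k} (suc n) {u} i
  with ∈-cartesianProductWith⁻ _∷_ (letters k) (words k n) (subst (u ∈_) (words-suc k n) i)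
... | a , v , a∈ , v∈ , refl = cong suc (proj₁ (∈-words⁻ n v∈)) ,
  λ { (here refl) → ∈-letters⁻ a∈ ; (there j) → proj₂ (∈-words⁻ n v∈) j }

words-unique : ∀ k n → Unique (words k n)
words-unique k zero    = All.[] ∷ []
words-unique k (suc n) = subst Unique (sym (words-suc k n))
  (Unique.cartesianProductWith⁺ _∷_ List.∷-injective
    (Unique.map⁺ ℕ.suc-injective (Unique.upTo⁺ k)) (words-unique k n))

-- Increasing maps and the subsets that are their images

record Increasing (N p : ℕ) (f : ℕ → ℕ) : Set where
  field
    positive : ∀ {c} → 1 ≤ c → c ≤ p → 1 ≤ f c
    bounded  : ∀ {c} → 1 ≤ c → c ≤ p → f c ≤ N
    mono     : ∀ {c d} → 1 ≤ c → c < d → d ≤ p → f c < f d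

open Increasing

-- The p-element subsets of [N], each listed from its maximum down. Splitting on whether the largest
-- admissible element belongs to the subset is Pascal's rule.
decreasings : ℕ → ℕ → List (List ℕ)
decreasings N       zero    = [] ∷ []
decreasings zero    (suc p) = []
decreasings (suc N) (suc p) = map (suc N ∷_) (decreasings N p) ++ decreasings N (suc p)

length-decreasings : ∀ N p → length (decreasings N p) ≡ N C p
length-decreasings zero    zero    = refl
length-decreasings (suc N) zero    = refl
length-decreasings zero    (suc p) = refl
length-decreasings (suc N) (suc p) =
  trans (List.length-++ (map (suc N ∷_) (decreasings N p)))
    (trans (cong₂ ℕ._+_ (trans (List.length-map _ (decreasings N p)) (length-decreasings N p)) (length-decreasings N (suc p)))
      (nCk+nC[k+1]≡[n+1]C[k+1] N p))

-- Entries of a decreasing list are numbered from its end, starting with 1.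
entryAt : List ℕ → ℕ → ℕ
entryAt []      c = 0
entryAt (x ∷ e) c = if c ≡ᵇ suc (length e) then x else entryAt e c

≡ᵇ-refl : ∀ n → (n ≡ᵇ n) ≡ true
≡ᵇ-refl n = T-ext (λ _ → tt) (λ _ → ℕ.≡⇒≡ᵇ n n refl)

≢⇒≡ᵇ≡false : ∀ {m n} → m ≢ n → (m ≡ᵇ n) ≡ false
≢⇒≡ᵇ≡false {m} {n} m≢n = ¬T⇒≡false (m≢n ∘ ℕ.≡ᵇ⇒≡ m n)

entryAt-head : ∀ {x} e {p} → length e ≡ p → entryAt (x ∷ e) (suc p) ≡ x
entryAt-head e refl rewrite ≡ᵇ-refl (length e) = refl

entryAt-tail : ∀ {x} e {p c} → length e ≡ p → c ≤ p → entryAt (x ∷ e) c ≡ entryAt e c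
entryAt-tail e refl c≤p rewrite ≢⇒≡ᵇ≡false (ℕ.<⇒≢ (s≤s c≤p)) = refl

entryAt-injective : ∀ {p} e e′ → length e ≡ p → length e′ ≡ p →
  (∀ {c} → 1 ≤ c → c ≤ p → entryAt e c ≡ entryAt e′ c) → e ≡ e′
entryAt-injective {zero}  []      []        _ _ _ = refl
entryAt-injective {suc p} (x ∷ e) (x′ ∷ e′) q q′ eq = cong₂ _∷_
  (trans (sym (entryAt-head e len)) (trans (eq (s≤s z≤n) ℕ.≤-refl) (entryAt-head e′ len′)))
  (entryAt-injective e e′ len len′ λ 1≤c c≤p →
    trans (sym (entryAt-tail e len c≤p)) (trans (eq 1≤c (ℕ.m≤n⇒m≤1+n c≤p)) (entryAt-tail e′ len′ c≤p)))
  where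
  len : length e ≡ p
  len = ℕ.suc-injective q
  len′ : length e′ ≡ p
  len′ = ℕ.suc-injective q′

∈-decreasings-length : ∀ N p {e} → e ∈ decreasings N p → length e ≡ p
∈-decreasings-length N       zero    (here refl) = refl
∈-decreasings-length (suc N) (suc p) i with ∈-++⁻ (map (suc N ∷_) (decreasings N p)) i
... | inj₂ j = ∈-decreasings-length N (suc p) j
... | inj₁ j with ∈-map⁻ (suc N ∷_) j
...   | e , e∈ , refl = cong suc (∈-decreasings-length N p e∈)

Increasing-weaken : ∀ {N p f} → Increasing N p f → Increasing (suc N) p f
Increasing-weaken inc = record
  { positive = positive inc
  ; bounded  = λ 1≤c c≤p → ℕ.m≤n⇒m≤1+n (bounded inc 1≤c c≤p)
  ; mono     = mono inc
  }

∈-decreasings⇒Increasing : ∀ N p {e} → e ∈ decreasings N p → Increasing N p (entryAt e)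
∈-decreasings⇒Increasing N zero _ = record
  { positive = λ 1≤c c≤0 → ⊥-elim (ℕ.<⇒≱ 1≤c c≤0)
  ; bounded  = λ 1≤c c≤0 → ⊥-elim (ℕ.<⇒≱ 1≤c c≤0)
  ; mono     = λ { _ () z≤n }
  }
∈-decreasings⇒Increasing (suc N) (suc p) i with ∈-++⁻ (map (suc N ∷_) (decreasings N p)) i
... | inj₂ j = Increasing-weaken (∈-decreasings⇒Increasing N (suc p) j)
... | inj₁ j with ∈-map⁻ (suc N ∷_) j
...   | e , e∈ , refl = record
  { positive = λ 1≤c c≤ → [ (λ { (s≤s c≤p) → subst (1 ≤_) (sym (tail c≤p)) (positive inc 1≤c c≤p) })
                          , (λ { refl → subst (1 ≤_) (sym head) (s≤s z≤n) }) ]′ (ℕ.m≤n⇒m<n∨m≡n c≤)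
  ; bounded  = λ 1≤c c≤ → [ (λ { (s≤s c≤p) → subst (_≤ suc N) (sym (tail c≤p)) (ℕ.m≤n⇒m≤1+n (bounded inc 1≤c c≤p)) })
                          , (λ { refl → ℕ.≤-reflexive head }) ]′ (ℕ.m≤n⇒m<n∨m≡n c≤)
  -- If `d` is the top index, its entry is the new maximum N+1, while every entry of `e` is at most
  -- N; otherwise both entries lie in `e`.
  ; mono     = λ {c} {d} 1≤c c<d d≤ →
      [ (λ { (s≤s d≤p) → subst (_< entryAt (suc N ∷ e) d) (sym (tail (ℕ.<⇒≤ (ℕ.<-≤-trans c<d d≤p))))
                           (subst (entryAt e c <_) (sym (tail d≤p)) (mono inc 1≤c c<d d≤p)) })
      , (λ { refl → subst (_< entryAt (suc N ∷ e) d) (sym (tail (ℕ.≤-pred c<d)))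
                      (subst (entryAt e c <_) (sym head) (s≤s (bounded inc 1≤c (ℕ.≤-pred c<d)))) })
      ]′ (ℕ.m≤n⇒m<n∨m≡n d≤)
  }
  where
  inc : Increasing N p (entryAt e)
  inc = ∈-decreasings⇒Increasing N p e∈
  head : entryAt (suc N ∷ e) (suc p) ≡ suc N
  head = entryAt-head e (∈-decreasings-length N p e∈)
  tail : ∀ {c} → c ≤ p → entryAt (suc N ∷ e) c ≡ entryAt e c
  tail = entryAt-tail e (∈-decreasings-length N p e∈)

decreasings-unique : ∀ N p → Unique (decreasings N p)
decreasings-unique N       zero    = All.[] ∷ []
decreasings-unique zero    (suc p) = []
decreasings-unique (suc N) (suc p) = Unique.++⁺
  (Unique.map⁺ List.∷-injectiveʳ (decreasings-unique N p)) (decreasings-unique N (suc p)) disjoint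
  where
  disjoint : ∀ {e} → ¬ (e ∈ map (suc N ∷_) (decreasings N p) × e ∈ decreasings N (suc p))
  disjoint (i , j) with ∈-map⁻ (suc N ∷_) i
  -- A common list would have its entry number p+1 equal to N+1 by the first description and at most
  -- N by the second.
  ... | e , e∈ , refl = ℕ.1+n≰n (subst (_≤ N) (entryAt-head e (∈-decreasings-length N p e∈))
          (bounded (∈-decreasings⇒Increasing N (suc p) j) (s≤s z≤n) ℕ.≤-refl))

valuesFrom : (ℕ → ℕ) → ℕ → List ℕ
valuesFrom f zero    = []
valuesFrom f (suc p) = f (suc p) ∷ valuesFrom f p

length-valuesFrom : ∀ f p → length (valuesFrom f p) ≡ p
length-valuesFrom f zero    = refl
length-valuesFrom f (suc p) = cong suc (length-valuesFrom f p)

entryAt-valuesFrom : ∀ f {p c} → 1 ≤ c → c ≤ p → entryAt (valuesFrom f p) c ≡ f c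
entryAt-valuesFrom f {zero}  1≤c c≤0 = ⊥-elim (ℕ.<⇒≱ 1≤c c≤0)
entryAt-valuesFrom f {suc p} 1≤c c≤ with ℕ.m≤n⇒m<n∨m≡n c≤
... | inj₁ (s≤s c≤p) = trans (entryAt-tail (valuesFrom f p) (length-valuesFrom f p) c≤p) (entryAt-valuesFrom f 1≤c c≤p)
... | inj₂ refl      = entryAt-head (valuesFrom f p) (length-valuesFrom f p)

-- The largest value, taken at the last argument, decides the branch: if it is at most N, it bounds
-- all values by N; if it is N+1, the earlier values lie strictly below it.
valuesFrom-∈-decreasings : ∀ N p {f} → Increasing N p f → valuesFrom f p ∈ decreasings N p
valuesFrom-∈-decreasings N       zero    inc = here refl
valuesFrom-∈-decreasings zero    (suc p) inc =
  ⊥-elim (ℕ.<⇒≱ (positive inc {1} ℕ.≤-refl (s≤s z≤n)) (bounded inc ℕ.≤-refl (s≤s z≤n)))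
valuesFrom-∈-decreasings (suc N) (suc p) {f} inc with ℕ.m≤n⇒m<n∨m≡n (bounded inc (s≤s z≤n) ℕ.≤-refl)
... | inj₁ (s≤s top≤N) = ∈-++⁺ʳ (map (suc N ∷_) (decreasings N p)) (valuesFrom-∈-decreasings N (suc p) record
  { positive = positive inc
  ; bounded  = λ {c} 1≤c c≤ → [ (λ c<sp → ℕ.≤-trans (ℕ.<⇒≤ (mono inc 1≤c c<sp ℕ.≤-refl)) top≤N)
                              , (λ { refl → top≤N }) ]′ (ℕ.m≤n⇒m<n∨m≡n c≤)
  ; mono     = mono inc
  })
... | inj₂ top≡ = ∈-++⁺ˡ (subst (λ x → x ∷ valuesFrom f p ∈ map (suc N ∷_) (decreasings N p)) (sym top≡)
  (∈-map⁺ (suc N ∷_) (valuesFrom-∈-decreasings N p record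
    { positive = λ 1≤c c≤p → positive inc 1≤c (ℕ.m≤n⇒m≤1+n c≤p)
    ; bounded  = λ {c} 1≤c c≤p → ℕ.≤-pred (subst (f c <_) top≡ (mono inc 1≤c (s≤s c≤p) ℕ.≤-refl))
    ; mono     = λ 1≤c c<d d≤p → mono inc 1≤c c<d (ℕ.m≤n⇒m≤1+n d≤p)
    })))

-- Order-isomorphic words as images of increasing maps

-- Takes the first entry opposite `c`, with 0 as default. For order-isomorphic words the choice is
-- immaterial, since equal letters face equal letters.
partner : List (ℕ × ℕ) → ℕ → ℕ
partner []            c = 0
partner ((x , t) ∷ Z) c = if t ≡ᵇ c then x else partner Z c

partner-∈ : ∀ {Z x c} → (x , c) ∈ Z → (partner Z c , c) ∈ Z
partner-∈ {(x , t) ∷ Z} {c = c} i with t ℕ.≟ c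
... | yes refl rewrite ≡ᵇ-refl t = here refl
... | no t≢c rewrite ≢⇒≡ᵇ≡false t≢c with i
...   | here refl = ⊥-elim (t≢c refl)
...   | there j   = there (partner-∈ j)

graph⇒≡map : ∀ u v {f} → length u ≡ length v → (∀ {x c} → (x , c) ∈ zipL u v → x ≡ f c) → u ≡ map f v
graph⇒≡map []      []      e g = refl
graph⇒≡map (x ∷ u) (c ∷ v) e g = cong₂ _∷_ (g (here refl)) (graph⇒≡map u v (ℕ.suc-injective e) (g ∘ there))

zipL-map : ∀ f v → zipL (map f v) v ≡ map (λ c → f c , c) v
zipL-map f []      = refl
zipL-map f (c ∷ v) = cong ((f c , c) ∷_) (zipL-map f v)

map-≗-on : ∀ {A B : Set} {f g : A → B} v → (∀ {c} → c ∈ v → f c ≡ g c) → map f v ≡ map g v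
map-≗-on []      h = refl
map-≗-on (c ∷ v) h = cong₂ _∷_ (h (here refl)) (map-≗-on v (h ∘ there))

map-≡⇒≗-on : ∀ {A B : Set} {f g : A → B} v → map f v ≡ map g v → ∀ {c} → c ∈ v → f c ≡ g c
map-≡⇒≗-on (c ∷ v) e (here refl) = List.∷-injectiveˡ e
map-≡⇒≗-on (c ∷ v) e (there i)   = map-≡⇒≗-on v (List.∷-injectiveʳ e) i

module Count (p : ℕ) (v : List ℕ) (letter-range : ∀ {c} → c ∈ v → 1 ≤ c × c ≤ p)
             (all-letters : ∀ {c} → 1 ≤ c → c ≤ p → c ∈ v) where

  Increasing⇒orderIso : ∀ {N f} → Increasing N p f → T (orderIso (map f v) v)
  Increasing⇒orderIso {N} {f} inc = orderIso⁺ (List.length-map f v) related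
    where
    related′ : ∀ {c d} → c ∈ v → d ∈ v → T (sameRel (f c , c) (f d , d))
    related′ {c} {d} i j with ℕ.<-cmp c d
    ... | tri< c<d _ _  = sameRel-both-< (mono inc (proj₁ (letter-range i)) c<d (proj₂ (letter-range j))) c<d
    ... | tri≈ _ refl _ = sameRel-refl {f c} {c}
    ... | tri> _ _ d<c  = sameRel-both-> (mono inc (proj₁ (letter-range j)) d<c (proj₂ (letter-range i))) d<c
    related : ∀ {p q} → p ∈ zipL (map f v) v → q ∈ zipL (map f v) v → T (sameRel p q)
    related {p} {q} i j with ∈-map⁻ _ (subst (p ∈_) (zipL-map f v) i) | ∈-map⁻ _ (subst (q ∈_) (zipL-map f v) j)
    ... | c , c∈ , refl | d , d∈ , refl = related′ c∈ d∈

  module _ {N u} (iso : T (orderIso u v)) (u-range : ∀ {x} → x ∈ u → 1 ≤ x × x ≤ N) where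

    image : ℕ → ℕ
    image = partner (zipL u v)

    image-∈ : ∀ {c} → 1 ≤ c → c ≤ p → (image c , c) ∈ zipL u v
    image-∈ 1≤c c≤p = partner-∈ (proj₂ (∈-zipL⁺ʳ (orderIso-length {u} {v} iso) (all-letters 1≤c c≤p)))

    image-increasing : Increasing N p image
    image-increasing = record
      { positive = λ 1≤c c≤p → proj₁ (u-range (proj₁ (∈-zipL⁻ (image-∈ 1≤c c≤p))))
      ; bounded  = λ 1≤c c≤p → proj₂ (u-range (proj₁ (∈-zipL⁻ (image-∈ 1≤c c≤p))))
      ; mono     = λ 1≤c c<d d≤p → sameRel-< (orderIso⁻ {u} {v} iso
          (image-∈ 1≤c (ℕ.<⇒≤ (ℕ.<-≤-trans c<d d≤p))) (image-∈ (ℕ.≤-trans 1≤c (ℕ.<⇒≤ c<d)) d≤p)) c<d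
      }

    -- Every occurrence of a letter `c` in `v` faces the same letter of `u` as the occurrence
    -- selected by `partner`, by preservation of equalities.
    ≡map-image : u ≡ map image v
    ≡map-image = graph⇒≡map u v (orderIso-length {u} {v} iso) λ {x} {c} i →
      let 1≤c , c≤p = letter-range (proj₂ (∈-zipL⁻ {u} i)) in
      sameRel-≡ {x} {image c} {c} {c} (orderIso⁻ {u} {v} iso i (image-∈ 1≤c c≤p)) refl

  -- Here `a` is the number of admissible letters, hence the strict bound `suc a`; for `v` equal to
  -- `τ′` this is definitionally `fits (suc a)`.
  below : ℕ → List ℕ → Bool
  below a u = orderIso u v ∧ allB (_<ᵇ suc a) u

  -- Such a word is the image of `v` under a unique increasing map from [p] to [a], that is, under
  -- the choice of a p-element subset of [a]. The bound `a ≤ k` places all these images among the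
  -- words over [k].
  count-orderIso : ∀ {k a} → a ≤ k → length (filter (T? ∘ below a) (words k (length v))) ≡ a C p
  count-orderIso {k} {a} a≤k = trans (ℕ.≤-antisym
      (length-≤-by-matching R (λ { (_ , refl) (_ , refl) → refl })
        (Unique.filter⁺ (T? ∘ below a) (words-unique k (length v))) toChoice)
      (length-≤-by-matching (λ e u → R u e) R-injective (decreasings-unique a p) toWord))
    (length-decreasings a p)
    where
    -- Membership is part of the relation because injectivity in `e` compares lists through their
    -- numbered entries, which requires the common length p.
    R : List ℕ → List ℕ → Set
    R u e = e ∈ decreasings a p × u ≡ map (entryAt e) v

    R-injective : ∀ {e e′ u} → R u e → R u e′ → e ≡ e′
    R-injective {e} {e′} (i , refl) (j , eq) = entryAt-injective e e′
      (∈-decreasings-length a p i) (∈-decreasings-length a p j)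
      (λ 1≤c c≤p → map-≡⇒≗-on v eq (all-letters 1≤c c≤p))

    toChoice : ∀ {u} → u ∈ filter (T? ∘ below a) (words k (length v)) → ∃[ e ] e ∈ decreasings a p × R u e
    toChoice {u} i = valuesFrom f p , e∈ , e∈ ,
      trans (≡map-image {a} {u} iso range) (map-≗-on v λ c∈ →
        sym (entryAt-valuesFrom f (proj₁ (letter-range c∈)) (proj₂ (letter-range c∈))))
      where
      u∈ : u ∈ words k (length v) × T (below a u)
      u∈ = ∈-filter⁻ (T? ∘ below a) {xs = words k (length v)} i
      iso : T (orderIso u v)
      iso = proj₁ (∧⁻ (proj₂ u∈))
      range : ∀ {x} → x ∈ u → 1 ≤ x × x ≤ a
      range {x} j = proj₁ (proj₂ (∈-words⁻ (length v) (proj₁ u∈)) j) ,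
        ℕ.≤-pred (ℕ.<ᵇ⇒< x (suc a) (allB⁻ (proj₂ (∧⁻ {orderIso u v} (proj₂ u∈))) j))
      f : ℕ → ℕ
      f = image {a} {u} iso range
      e∈ : valuesFrom f p ∈ decreasings a p
      e∈ = valuesFrom-∈-decreasings a p (image-increasing {a} {u} iso range)

    toWord : ∀ {e} → e ∈ decreasings a p → ∃[ u ] u ∈ filter (T? ∘ below a) (words k (length v)) × R u e
    toWord {e} i = w , ∈-filter⁺ (T? ∘ below a)
        (subst (λ n → w ∈ words k n) (List.length-map (entryAt e) v)
          (∈-words⁺ w λ j → proj₁ (range j) , ℕ.≤-trans (proj₂ (range j)) a≤k))
        (∧⁺ (Increasing⇒orderIso inc) (allB⁺ w λ j → ℕ.<⇒<ᵇ (s≤s (proj₂ (range j)))))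
      , i , refl
      where
      inc : Increasing a p (entryAt e)
      inc = ∈-decreasings⇒Increasing a p i
      w : List ℕ
      w = map (entryAt e) v
      range : ∀ {x} → x ∈ w → 1 ≤ x × x ≤ a
      range j with ∈-map⁻ (entryAt e) j
      ... | c , c∈ , refl = let 1≤c , c≤p = letter-range c∈ in positive inc 1≤c c≤p , bounded inc 1≤c c≤p

-- Finite sums

sumOver : {A : Set} → List A → (A → ℤ) → ℤ
sumOver []       f = + 0
sumOver (x ∷ xs) f = f x ℤ.+ sumOver xs f

sumOver-cong-∈ : ∀ {A : Set} (xs : List A) {f g} → (∀ {x} → x ∈ xs → f x ≡ g x) → sumOver xs f ≡ sumOver xs g
sumOver-cong-∈ []       h = refl
sumOver-cong-∈ (x ∷ xs) h = cong₂ ℤ._+_ (h (here refl)) (sumOver-cong-∈ xs (h ∘ there))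

sumOver-cong : ∀ {A : Set} (xs : List A) {f g} → (∀ x → f x ≡ g x) → sumOver xs f ≡ sumOver xs g
sumOver-cong xs h = sumOver-cong-∈ xs (λ {x} _ → h x)

sumOver-zero : ∀ {A : Set} (xs : List A) {f} → (∀ {x} → x ∈ xs → f x ≡ + 0) → sumOver xs f ≡ + 0
sumOver-zero []       h = refl
sumOver-zero (x ∷ xs) h = cong₂ ℤ._+_ (h (here refl)) (sumOver-zero xs (h ∘ there))

sumOver-- : ∀ {A : Set} (xs : List A) f g → sumOver xs (λ x → f x ℤ.- g x) ≡ sumOver xs f ℤ.- sumOver xs g
sumOver-- []       f g = refl
sumOver-- (x ∷ xs) f g = trans (cong (ℤ._+_ (f x ℤ.- g x)) (sumOver-- xs f g))
  (rearrange (f x) (g x) (sumOver xs f) (sumOver xs g))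
  where
  rearrange : ∀ a b c d → (a ℤ.- b) ℤ.+ (c ℤ.- d) ≡ (a ℤ.+ c) ℤ.- (b ℤ.+ d)
  rearrange = ℤ-solve-∀

sumOver-*ˡ : ∀ {A : Set} (xs : List A) c f → sumOver xs (λ x → c ℤ.* f x) ≡ c ℤ.* sumOver xs f
sumOver-*ˡ []       c f = sym (ℤ.*-zeroʳ c)
sumOver-*ˡ (x ∷ xs) c f = trans (cong (ℤ._+_ (c ℤ.* f x)) (sumOver-*ˡ xs c f)) (sym (ℤ.*-distribˡ-+ c _ _))

sumOver-*ʳ : ∀ {A : Set} (xs : List A) f c → sumOver xs (λ x → f x ℤ.* c) ≡ sumOver xs f ℤ.* c
sumOver-*ʳ xs f c = trans (sumOver-cong xs (λ x → ℤ.*-comm (f x) c))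
  (trans (sumOver-*ˡ xs c f) (ℤ.*-comm c _))

sumOver-++ : ∀ {A : Set} (xs ys : List A) f → sumOver (xs ++ ys) f ≡ sumOver xs f ℤ.+ sumOver ys f
sumOver-++ []       ys f = sym (ℤ.+-identityˡ _)
sumOver-++ (x ∷ xs) ys f = trans (cong (ℤ._+_ (f x)) (sumOver-++ xs ys f)) (sym (ℤ.+-assoc (f x) _ _))

sumOver-map : ∀ {A B : Set} (g : A → B) xs f → sumOver (map g xs) f ≡ sumOver xs (f ∘ g)
sumOver-map g []       f = refl
sumOver-map g (x ∷ xs) f = cong (ℤ._+_ (f (g x))) (sumOver-map g xs f)

sumOver-concatMap : ∀ {A B : Set} (g : A → List B) xs f →
  sumOver (concatMap g xs) f ≡ sumOver xs (λ x → sumOver (g x) f)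
sumOver-concatMap g []       f = refl
sumOver-concatMap g (x ∷ xs) f =
  trans (sumOver-++ (g x) (concatMap g xs) f) (cong (ℤ._+_ (sumOver (g x) f)) (sumOver-concatMap g xs f))

sumOver-words-suc : ∀ k n f →
  sumOver (words k (suc n)) f ≡ sumOver (letters k) (λ a → sumOver (words k n) (λ σ → f (a ∷ σ)))
sumOver-words-suc k n f = trans (sumOver-concatMap _ (letters k) f)
  (sumOver-cong (letters k) (λ a → sumOver-map (a ∷_) (words k n) f))

sumOver-words-+ : ∀ k p q f →
  sumOver (words k (p ℕ.+ q)) f ≡ sumOver (words k p) (λ u → sumOver (words k q) (λ v → f (u ++ v)))
sumOver-words-+ k zero    q f = sym (ℤ.+-identityʳ _)
sumOver-words-+ k (suc p) q f = begin
  sumOver (words k (suc p ℕ.+ q)) f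
    ≡⟨ sumOver-words-suc k (p ℕ.+ q) f ⟩
  sumOver (letters k) (λ a → sumOver (words k (p ℕ.+ q)) (λ σ → f (a ∷ σ)))
    ≡⟨ sumOver-cong (letters k) (λ a → sumOver-words-+ k p q (λ σ → f (a ∷ σ))) ⟩
  sumOver (letters k) (λ a → sumOver (words k p) (λ u → sumOver (words k q) (λ v → f (a ∷ u ++ v))))
    ≡⟨ sumOver-words-suc k p _ ⟨
  sumOver (words k (suc p)) (λ u → sumOver (words k q) (λ v → f (u ++ v))) ∎
  where open ≡-Reasoning

sumOver-letters : ∀ k g → sumOver (letters k) g ≡ Σ< k (g ∘ suc)
sumOver-letters k g = trans (sumOver-map suc (upTo k) g) (applyUpTo-sum id k)
  where
  applyUpTo-sum : ∀ h n → sumOver (applyUpTo h n) (g ∘ suc) ≡ Σ< n (g ∘ suc ∘ h)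
  applyUpTo-sum h zero    = refl
  applyUpTo-sum h (suc n) = trans (cong (ℤ._+_ (g (suc (h 0)))) (applyUpTo-sum (h ∘ suc) n))
    (sym (Σ<-front n (g ∘ suc ∘ h)))

ind : Bool → ℤ
ind b = if b then + 1 else + 0

length-filter : ∀ {A : Set} {P : Pred A 0ℓ} (P? : Decidable P) xs →
  + length (filter P? xs) ≡ sumOver xs (ind ∘ does ∘ P?)
length-filter P? [] = refl
length-filter P? (x ∷ xs) with does (P? x)
... | true  = cong (ℤ._+_ (+ 1)) (length-filter P? xs)
... | false = trans (length-filter P? xs) (sym (ℤ.+-identityˡ _))

Σ<-drop : ∀ k f → f 0 ≡ + 0 → Σ< (suc k) f ≡ Σ< k (f ∘ suc)
Σ<-drop k f f0≡0 = trans (Σ<-front k f) (trans (cong (ℤ._+ Σ< k (f ∘ suc)) f0≡0) (ℤ.+-identityˡ _))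

-- The index j stands for the letter j + 1.
Σ<-above : ℕ → ℕ → (ℕ → ℤ) → ℤ
Σ<-above k i g = Σ< k (λ j → ind (i <ᵇ suc j) ℤ.* g j)

Σ<-above-all : ∀ k g → Σ<-above k k g ≡ + 0
Σ<-above-all zero    g = refl
Σ<-above-all (suc k) g = trans (Σ<-drop k (λ j → ind (k <ᵇ j) ℤ.* g j) refl) (Σ<-above-all k (g ∘ suc))

Σ<-above-suc : ∀ {k i} g → i < k → Σ<-above k i g ≡ g i ℤ.+ Σ<-above k (suc i) g
Σ<-above-suc {suc k} {zero}  g _ = trans (Σ<-front k (λ j → + 1 ℤ.* g j))
  (cong₂ ℤ._+_ (ℤ.*-identityˡ (g 0)) (sym (Σ<-drop k (λ j → ind (0 <ᵇ j) ℤ.* g j) refl)))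
Σ<-above-suc {suc k} {suc i} g (s≤s i<k) = begin
  Σ<-above (suc k) (suc i) g                     ≡⟨ Σ<-drop k (λ j → ind (i <ᵇ j) ℤ.* g j) refl ⟩
  Σ<-above k i (g ∘ suc)                         ≡⟨ Σ<-above-suc (g ∘ suc) i<k ⟩
  g (suc i) ℤ.+ Σ<-above k (suc i) (g ∘ suc)     ≡⟨ cong (ℤ._+_ (g (suc i))) (Σ<-drop k (λ j → ind (suc i <ᵇ j) ℤ.* g j) refl) ⟨
  g (suc i) ℤ.+ Σ<-above (suc k) (suc (suc i)) g ∎
  where open ≡-Reasoning

-- Solving the linear recurrence and matching the denominator

module Identities (R : CommutativeRing 0ℓ 0ℓ) where
  open CommutativeRing R hiding (zero; refl; trans) renaming (_≈_ to _≋_; sym to ≋-sym)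
  open RingProperties (CommutativeRing.ring R) using (-‿distribˡ-*; -‿distribʳ-*; -‿+-comm)
  open SetoidReasoning setoid

  -- Adding T_a to the formula for G_a collects the coefficient of T_a into q_(a-1): `e` is 1 - y,
  -- `p` the power of x, `c` the binomial coefficient and `t` is T_a.
  step : ∀ f e p c t → (f + - (e * (p * (c * t)))) + t ≋ f + (1# + - (c * p * e)) * t
  step f e p c t = begin
    (f + - (e * (p * (c * t)))) + t   ≈⟨ +-assoc _ _ _ ⟩
    f + (- (e * (p * (c * t))) + t)   ≈⟨ +-congˡ (+-comm _ _) ⟩
    f + (t + - (e * (p * (c * t))))   ≈⟨ +-congˡ (+-cong (≋-sym (*-identityˡ t)) (-‿cong regroup)) ⟩
    f + (1# * t + - (c * p * e * t))  ≈⟨ +-congˡ (+-congˡ (-‿distribˡ-* _ _)) ⟩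
    f + (1# * t + - (c * p * e) * t)  ≈⟨ +-congˡ (distribʳ _ _ _) ⟨
    f + (1# + - (c * p * e)) * t      ∎
    where
    regroup : e * (p * (c * t)) ≋ c * p * e * t
    regroup = begin
      e * (p * (c * t)) ≈⟨ *-congˡ (*-assoc p c t) ⟨
      e * (p * c * t)   ≈⟨ *-assoc e (p * c) t ⟨
      e * (p * c) * t   ≈⟨ *-congʳ (*-comm e (p * c)) ⟩
      p * c * e * t     ≈⟨ *-congʳ (*-congʳ (*-comm p c)) ⟩
      c * p * e * t     ∎

  telescope : ∀ f s p q t → f * s + p * (f + q * t) ≋ f * (s + p) + p * q * t
  telescope f s p q t = begin
    f * s + p * (f + q * t)         ≈⟨ +-congˡ (distribˡ _ _ _) ⟩
    f * s + (p * f + p * (q * t))   ≈⟨ +-assoc _ _ _ ⟨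
    f * s + p * f + p * (q * t)     ≈⟨ +-cong (+-congˡ (*-comm p f)) (≋-sym (*-assoc p q t)) ⟩
    f * s + f * p + p * q * t       ≈⟨ +-congʳ (distribˡ _ _ _) ⟨
    f * (s + p) + p * q * t         ∎

  collect : ∀ f c x s → f * ((1# + - (c * x)) + - (x * s)) ≋ f + - (x * (f * (c + s)))
  collect f c x s = begin
    f * ((1# + - (c * x)) + - (x * s))   ≈⟨ *-congˡ (+-assoc _ _ _) ⟩
    f * (1# + (- (c * x) + - (x * s)))   ≈⟨ *-congˡ (+-congˡ (-‿+-comm _ _)) ⟩
    f * (1# + - (c * x + x * s))         ≈⟨ distribˡ _ _ _ ⟩
    f * 1# + f * - (c * x + x * s)       ≈⟨ +-cong (*-identityʳ f) (≋-sym (-‿distribʳ-* _ _)) ⟩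
    f + - (f * (c * x + x * s))          ≈⟨ +-congˡ (-‿cong (*-congˡ (+-congʳ (*-comm c x)))) ⟩
    f + - (f * (x * c + x * s))          ≈⟨ +-congˡ (-‿cong (*-congˡ (distribˡ _ _ _))) ⟨
    f + - (f * (x * (c + s)))            ≈⟨ +-congˡ (-‿cong (*-assoc _ _ _)) ⟨
    f + - (f * x * (c + s))              ≈⟨ +-congˡ (-‿cong (*-congʳ (*-comm f x))) ⟩
    f + - (x * f * (c + s))              ≈⟨ +-congˡ (-‿cong (*-assoc _ _ _)) ⟩
    f + - (x * (f * (c + s)))            ∎

  -- Multiplying out gives `f` minus x times `f * (c + s)`, that is f - x t, which is 1. In the
  -- application `c` is the constant from the trivial terms of the sum and `s` the rest.
  inverse : ∀ {f t} c x s → f ≋ 1# + x * t → t ≋ f * (c + s) → f * ((1# + - (c * x)) + - (x * s)) ≋ 1#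
  inverse {f} {t} c x s f≋ t≋ = begin
    f * ((1# + - (c * x)) + - (x * s)) ≈⟨ collect f c x s ⟩
    f + - (x * (f * (c + s)))          ≈⟨ +-cong f≋ (-‿cong (*-congˡ (≋-sym t≋))) ⟩
    (1# + x * t) + - (x * t)           ≈⟨ +-assoc _ _ _ ⟩
    1# + (x * t + - (x * t))           ≈⟨ +-congˡ (-‿inverseʳ _) ⟩
    1# + 0#                            ≈⟨ +-identityʳ 1# ⟩
    1#                                 ∎

open CommutativeRing psRing using (setoid; +-congˡ; +-congʳ; *-congˡ; *-congʳ; +-identityʳ; +-identityˡ; +-assoc; *-identityˡ; *-identityʳ; *-assoc; zeroˡ; zeroʳ)
  renaming (refl to ≈-refl; sym to ≈-sym; trans to ≈-trans; +-cong to ⊕-cong; *-cong to ⊗-cong; -‿cong to neg-cong; distribʳ to ⊗-distribʳ-⊕)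
open Identities psRing

sumPS-cong : ∀ n {f g} → (∀ i → f i ≈ g i) → sumPS n f ≈ sumPS n g
sumPS-cong zero    h = ≈-refl
sumPS-cong (suc n) h = ⊕-cong (sumPS-cong n h) (h n)

prodPS-cong : ∀ n {f g} → (∀ i → f i ≈ g i) → prodPS n f ≈ prodPS n g
prodPS-cong zero    h = ≈-refl
prodPS-cong (suc n) h = ⊗-cong (prodPS-cong n h) (h n)

sumPS-+ : ∀ a b f → sumPS (a ℕ.+ b) f ≈ sumPS a f ⊕ sumPS b (λ i → f (a ℕ.+ i))
sumPS-+ a zero    f rewrite ℕ.+-identityʳ a = ≈-sym (+-identityʳ (sumPS a f))
sumPS-+ a (suc b) f rewrite ℕ.+-suc a b =
  ≈-trans (⊕-cong (sumPS-+ a b f) ≈-refl) (+-assoc (sumPS a f) (sumPS b (λ i → f (a ℕ.+ i))) (f (a ℕ.+ b)))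

prodPS-+ : ∀ a b f → prodPS (a ℕ.+ b) f ≈ prodPS a f ⊗ prodPS b (λ i → f (a ℕ.+ i))
prodPS-+ a zero    f rewrite ℕ.+-identityʳ a = ≈-sym (*-identityʳ (prodPS a f))
prodPS-+ a (suc b) f rewrite ℕ.+-suc a b =
  ≈-trans (*-congʳ {f (a ℕ.+ b)} (prodPS-+ a b f)) (*-assoc (prodPS a f) (prodPS b (λ i → f (a ℕ.+ i))) (f (a ℕ.+ b)))

prodPS-ones : ∀ n {f} → (∀ {i} → i < n → f i ≈ onePS) → prodPS n f ≈ onePS
prodPS-ones zero    h = ≈-refl
prodPS-ones (suc n) {f} h = ≈-trans (⊗-cong (prodPS-ones n (λ i<n → h (ℕ.m<n⇒m<1+n i<n))) (h (ℕ.n<1+n n))) (*-identityˡ onePS)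

constPS-+ : ∀ a b → constPS (a ℤ.+ b) ≈ constPS a ⊕ constPS b
constPS-+ a b zero    zero    = refl
constPS-+ a b zero    (suc s) = refl
constPS-+ a b (suc n) s       = refl

sumPS-ones : ∀ n {f} → (∀ {i} → i < n → f i ≈ onePS) → sumPS n f ≈ constPS (+ n)
sumPS-ones zero    h = ≈-refl
sumPS-ones (suc n) {f} h = begin
  sumPS n f ⊕ f n               ≈⟨ ⊕-cong (sumPS-ones n (λ i<n → h (ℕ.m<n⇒m<1+n i<n))) (h (ℕ.n<1+n n)) ⟩
  constPS (+ n) ⊕ constPS (+ 1) ≈⟨ constPS-+ (+ n) (+ 1) ⟨
  constPS (+ (n ℕ.+ 1))         ≡⟨ cong (constPS ∘ +_) (ℕ.+-comm n 1) ⟩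
  constPS (+ suc n)             ∎
  where open SetoidReasoning setoid

-- After i substitutions the sum has i terms and the remainder is `prodPS i q ⊗ t i`; this is the
-- invariant `unfold`, and at i = k the remainder vanishes.
linear-recurrence : ∀ k {F q} {t : ℕ → PS} → (∀ {i} → i < k → t i ≈ F ⊕ q i ⊗ t (suc i)) → t k ≈ constPS (+ 0) →
  t 0 ≈ F ⊗ sumPS k (λ b → prodPS b q)
linear-recurrence k {F} {q} {t} rec t-k = begin
  t 0                                              ≈⟨ unfold k ℕ.≤-refl ⟩
  F ⊗ sumPS k (λ b → prodPS b q) ⊕ prodPS k q ⊗ t k ≈⟨ +-congˡ {F ⊗ S k} (≈-trans (*-congˡ {prodPS k q} t-k) (zeroʳ (prodPS k q))) ⟩
  F ⊗ sumPS k (λ b → prodPS b q) ⊕ constPS (+ 0)   ≈⟨ +-identityʳ (F ⊗ S k) ⟩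
  F ⊗ sumPS k (λ b → prodPS b q)                   ∎
  where
  open SetoidReasoning setoid
  S : ℕ → PS
  S i = sumPS i (λ b → prodPS b q)
  unfold : ∀ i → i ≤ k → t 0 ≈ F ⊗ S i ⊕ prodPS i q ⊗ t i
  unfold zero    _   = ≈-sym (≈-trans (⊕-cong (zeroʳ F) (*-identityˡ (t 0))) (+-identityˡ (t 0)))
  unfold (suc i) i<k = begin
    t 0                                               ≈⟨ unfold i (ℕ.<⇒≤ i<k) ⟩
    F ⊗ S i ⊕ prodPS i q ⊗ t i                        ≈⟨ +-congˡ {F ⊗ S i} (*-congˡ {prodPS i q} (rec i<k)) ⟩
    F ⊗ S i ⊕ prodPS i q ⊗ (F ⊕ q i ⊗ t (suc i))      ≈⟨ telescope F (S i) (prodPS i q) (q i) (t (suc i)) ⟩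
    F ⊗ (S i ⊕ prodPS i q) ⊕ prodPS i q ⊗ q i ⊗ t (suc i) ∎

factor : ℕ → ℕ → PS
factor c e = onePS ⊖ constPS (+ c) ⊗ powPS X e ⊗ (onePS ⊖ Y)

factor-zero : ∀ {c} e → c ≡ 0 → factor c e ≈ onePS
factor-zero e refl = begin
  factor 0 e                                   ≈⟨ +-congˡ {onePS} (neg-cong (*-congʳ {onePS ⊖ Y} (zeroˡ (powPS X e)))) ⟩
  onePS ⊖ constPS (+ 0) ⊗ (onePS ⊖ Y)          ≈⟨ +-congˡ {onePS} (neg-cong (zeroˡ (onePS ⊖ Y))) ⟩
  onePS ⊖ constPS (+ 0)                        ≈⟨ (λ { zero zero → refl ; zero (suc s) → refl ; (suc n) s → refl }) ⟩
  onePS                                        ∎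
  where open SetoidReasoning setoid

shiftZ-suc : ∀ M t → shiftZ (suc M) (suc t) ≡ + (M ℕ.+ t)
shiftZ-suc M t rewrite ℕ.+-suc t M = cong +_ (ℕ.+-comm t M)

-- The upper entry is M - 1. For M = 0 it is negative, where `binomZ` is 0 by convention; otherwise
-- it is a natural number smaller than the lower entry.
binomZ-shiftZ-zero : ∀ M → binomZ (shiftZ (suc M) 0) M ≡ 0
binomZ-shiftZ-zero zero    = refl
binomZ-shiftZ-zero (suc M) = k>n⇒nCk≡0 (ℕ.n<1+n M)

-- The terms with b < M are 1, since C(j, M) vanishes for j < M; likewise the
-- factor t = 0 on the right, whose binomial coefficient is C(M - 1, M).
reindex : ∀ M d e → sumPS (M ℕ.+ d) (λ b → prodPS b (λ j → factor (j C M) e)) ≈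
  constPS (+ M) ⊕ sumPS d (λ u → prodPS (suc u) (λ t → factor (binomZ (shiftZ (suc M) t) M) e))
reindex M d e = begin
  sumPS (M ℕ.+ d) (λ b → prodPS b q)
    ≈⟨ sumPS-+ M d (λ b → prodPS b q) ⟩
  sumPS M (λ b → prodPS b q) ⊕ sumPS d (λ u → prodPS (M ℕ.+ u) q)
    ≈⟨ ⊕-cong (sumPS-ones M λ {b} b<M → prodPS-ones b (λ j<b → q-one (ℕ.<-trans j<b b<M)))
              (sumPS-cong d shifted) ⟩
  constPS (+ M) ⊕ sumPS d (λ u → prodPS (suc u) q′) ∎
  where
  open SetoidReasoning setoid
  q q′ : ℕ → PS
  q j  = factor (j C M) e
  q′ t = factor (binomZ (shiftZ (suc M) t) M) e
  q-one : ∀ {j} → j < M → q j ≈ onePS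
  q-one j<M = factor-zero e (k>n⇒nCk≡0 j<M)
  shifted : ∀ u → prodPS (M ℕ.+ u) q ≈ prodPS (suc u) q′
  shifted u = begin
    prodPS (M ℕ.+ u) q                        ≈⟨ prodPS-+ M u q ⟩
    prodPS M q ⊗ prodPS u (λ t → q (M ℕ.+ t)) ≈⟨ ⊗-cong
       (≈-trans (prodPS-ones M q-one) (≈-sym (prodPS-ones 1 {q′} λ { (s≤s z≤n) → factor-zero e (binomZ-shiftZ-zero M) })))
       (prodPS-cong u λ t n s → cong (λ z → factor (binomZ z M) e n s) (sym (shiftZ-suc M t))) ⟩
    prodPS 1 q′ ⊗ prodPS u (q′ ∘ suc)         ≈⟨ prodPS-+ 1 u q′ ⟨
    prodPS (suc u) q′                         ∎

-- The recurrence for words by first letter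

δ : ℕ → ℕ → ℤ
δ n s = ind (n ≡ᵇ s)

-- The coefficients of y times y^n, as `δ n` are those of y^n; the coefficient of y^0 is therefore
-- 0.
δ-pred : ℕ → ℕ → ℤ
δ-pred n zero    = + 0
δ-pred n (suc s) = δ n s

-- The coefficient form of y^[t] y^n = y^n - [t] (1 - y) y^n.
δ-if : ∀ t n s → δ ((if t then 1 else 0) ℕ.+ n) s ≡ δ n s ℤ.- (ind t ℤ.* δ n s ℤ.- ind t ℤ.* δ-pred n s)
δ-if false n s       = sym (ℤ.+-identityʳ (δ n s))
δ-if true  n zero    = cancel (δ n 0)
  where
  cancel : ∀ a → + 0 ≡ a ℤ.- (+ 1 ℤ.* a ℤ.- + 1 ℤ.* + 0)
  cancel = ℤ-solve-∀
δ-if true  n (suc s) = cancel (δ n (suc s)) (δ n s)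
  where
  cancel : ∀ a b → b ≡ a ℤ.- (+ 1 ℤ.* a ℤ.- + 1 ℤ.* b)
  cancel = ℤ-solve-∀

[1-Y]-⊗ : ∀ f → (onePS ⊖ Y) ⊗ f ≈ f ⊖ Y ⊗ f
[1-Y]-⊗ f = begin
  (onePS ⊖ Y) ⊗ f                        ≈⟨ ⊗-distribʳ-⊕ f onePS (λ n s → ℤ.- Y n s) ⟩
  onePS ⊗ f ⊕ (λ n s → ℤ.- Y n s) ⊗ f    ≈⟨ ⊕-cong (*-identityˡ f) (≈-sym (-‿distribˡ-* Y f)) ⟩
  f ⊖ Y ⊗ f                              ∎
  where
  open SetoidReasoning setoid
  open RingProperties (CommutativeRing.ring psRing) using (-‿distribˡ-*)

tailSum : ℕ → ℕ → ℕ → PS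
tailSum m e d = sumPS d (λ u → prodPS (suc u) (λ t → factor (binomZ (shiftZ (suc m) t) m) e))

-- With successors as arguments the truncated subtractions in `denom` compute, and its factors are
-- literally those of `factor`.
denom≡ : ∀ m e k → denom (suc m) (suc e) k ≡ (onePS ⊖ constPS (+ m) ⊗ X ⊖ X ⊗ tailSum m e (suc (k ∸ suc m)))
denom≡ m e k = refl

inverse-denom : ∀ {f t} m e k → f ≈ onePS ⊕ X ⊗ t →
  t ≈ f ⊗ (constPS (+ m) ⊕ tailSum m e (suc (k ∸ suc m))) → f ⊗ denom (suc m) (suc e) k ≈ onePS
inverse-denom {f} {t} m e k f≈ t≈ = subst (λ D → f ⊗ D ≈ onePS) (sym (denom≡ m e k))
  (inverse {f} {t} (constPS (+ m)) X (tailSum m e (suc (k ∸ suc m))) f≈ t≈)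

-- Here m is one less than in the theorem.
module Recurrence (m : ℕ) (τ′ : List ℕ) (letter-range : ∀ {c} → c ∈ τ′ → 1 ≤ c × c ≤ m)
                  (all-letters : ∀ {c} → 1 ≤ c → c ≤ m → c ∈ τ′) (k : ℕ) where

  open Pattern (suc m) τ′ (λ i → s≤s (proj₂ (letter-range i)))
  open Count m τ′ letter-range all-letters

  -- The exponent l - 1: the letters of u together with one of the two end letters.
  gap : ℕ
  gap = suc (length τ′)

  F : PS
  F = Fτ τ k

  occursAt : ℕ → List ℕ → Bool
  occursAt a σ = orderIso (take (length τ) (a ∷ σ)) τ

  -- The first letter is not counted by the exponent of x in the next three series.
  startingWith : ℕ → PS
  startingWith a n s = sumOver (words k n) (λ σ → δ (occ τ (a ∷ σ)) s)

  startingAbove : ℕ → PS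
  startingAbove a n s = sumOver (letters k) (λ b → ind (a <ᵇ b) ℤ.* startingWith b n s)

  afterOccurrence : ℕ → PS
  afterOccurrence a n s = sumOver (words k n) (λ σ → ind (occursAt a σ) ℤ.* δ (occ τ σ) s)

  F-sum : ∀ n s → F n s ≡ sumOver (words k n) (λ σ → δ (occ τ σ) s)
  F-sum n s = length-filter (λ σ → occ τ σ ℕ.≟ s) (words k n)

  startingAbove-Σ< : ∀ a n s → startingAbove a n s ≡ Σ<-above k a (λ j → startingWith (suc j) n s)
  startingAbove-Σ< a n s = sumOver-letters k (λ b → ind (a <ᵇ b) ℤ.* startingWith b n s)

  startingAbove-suc : ∀ {i} → i < k → startingAbove i ≈ startingWith (suc i) ⊕ startingAbove (suc i)
  startingAbove-suc {i} i<k n s = trans (startingAbove-Σ< i n s)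
    (trans (Σ<-above-suc (λ j → startingWith (suc j) n s) i<k)
      (cong (ℤ._+_ (startingWith (suc i) n s)) (sym (startingAbove-Σ< (suc i) n s))))

  startingAbove-all : startingAbove k ≈ constPS (+ 0)
  startingAbove-all n s = trans (startingAbove-Σ< k n s)
    (trans (Σ<-above-all k (λ j → startingWith (suc j) n s)) (sym (constPS-0 n s)))

  F-by-first-letter : F ≈ onePS ⊕ X ⊗ startingAbove 0
  F-by-first-letter zero s = trans (empty s)
    (trans (sym (ℤ.+-identityʳ _)) (cong (ℤ._+_ (onePS 0 s)) (sym (X-⊗-zero (startingAbove 0) s))))
    where
    empty : ∀ s → F 0 s ≡ onePS 0 s
    empty zero    = refl
    empty (suc s) = refl
  F-by-first-letter (suc n) s = begin
    F (suc n) s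
      ≡⟨ F-sum (suc n) s ⟩
    sumOver (words k (suc n)) (λ σ → δ (occ τ σ) s)
      ≡⟨ sumOver-words-suc k n (λ σ → δ (occ τ σ) s) ⟩
    sumOver (letters k) (λ a → startingWith a n s)
      -- Letters start at 1, so every letter lies above 0 and the indicator is 1.
      ≡⟨ sumOver-cong-∈ (letters k) (λ {b} i → sym (above-zero b (∈-letters⁻ i))) ⟩
    startingAbove 0 n s
      ≡⟨ X-⊗-suc (startingAbove 0) n s ⟨
    (X ⊗ startingAbove 0) (suc n) s
      ≡⟨ ℤ.+-identityˡ _ ⟨
    (onePS ⊕ X ⊗ startingAbove 0) (suc n) s ∎
    where
    open ≡-Reasoning
    above-zero : ∀ b → 1 ≤ b × b ≤ k → ind (0 <ᵇ b) ℤ.* startingWith b n s ≡ startingWith b n s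
    above-zero (suc b) _ = ℤ.*-identityˡ _

  startingWith-split : ∀ a → startingWith a ≈ F ⊖ (onePS ⊖ Y) ⊗ afterOccurrence a
  startingWith-split a n s = begin
    startingWith a n s
      ≡⟨ sumOver-cong (words k n) (λ σ → δ-if (occursAt a σ) (occ τ σ) s) ⟩
    sumOver (words k n) (λ σ → δ (occ τ σ) s ℤ.- (B s σ ℤ.- B′ s σ))
      ≡⟨ sumOver-- (words k n) (λ σ → δ (occ τ σ) s) (λ σ → B s σ ℤ.- B′ s σ) ⟩
    sumOver (words k n) (λ σ → δ (occ τ σ) s) ℤ.- sumOver (words k n) (λ σ → B s σ ℤ.- B′ s σ)
      ≡⟨ cong₂ ℤ._-_ (sym (F-sum n s)) (trans (sumOver-- (words k n) (B s) (B′ s)) (cong (ℤ._-_ (afterOccurrence a n s)) (sym (Y-part s)))) ⟩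
    F n s ℤ.- (afterOccurrence a n s ℤ.- (Y ⊗ afterOccurrence a) n s)
      ≡⟨ cong (ℤ._-_ (F n s)) ([1-Y]-⊗ (afterOccurrence a) n s) ⟨
    (F ⊖ (onePS ⊖ Y) ⊗ afterOccurrence a) n s ∎
    where
    open ≡-Reasoning
    B B′ : ℕ → List ℕ → ℤ
    B  s σ = ind (occursAt a σ) ℤ.* δ (occ τ σ) s
    B′ s σ = ind (occursAt a σ) ℤ.* δ-pred (occ τ σ) s
    Y-part : ∀ s → (Y ⊗ afterOccurrence a) n s ≡ sumOver (words k n) (B′ s)
    Y-part zero    = trans (Y-⊗-zero (afterOccurrence a) n)
      (sym (sumOver-zero (words k n) (λ {σ} _ → ℤ.*-zeroʳ (ind (occursAt a σ)))))
    -- `δ-pred` at `suc s` reduces to `δ` at `s`, so multiplication by `Y` is exactly this index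
    -- shift.
    Y-part (suc s) = Y-⊗-suc (afterOccurrence a) n s

  -- Near the end of a word `take` returns fewer than l letters, and the length test inside
  -- `orderIso` rejects such a factor.
  afterOccurrence-short : ∀ a {n} s → n < gap → afterOccurrence a n s ≡ + 0
  afterOccurrence-short a {n} s n<l = sumOver-zero (words k n) λ {σ} σ∈ →
    cong (λ t → ind t ℤ.* δ (occ τ σ) s) (¬T⇒≡false (too-short σ (proj₁ (∈-words⁻ n σ∈))))
    where
    too-short : ∀ σ → length σ ≡ n → ¬ T (occursAt a σ)
    too-short σ refl t = ℕ.<-irrefl (orderIso-length {take (length τ) (a ∷ σ)} {τ} t) (begin-strict
      length (take (length τ) (a ∷ σ)) ≡⟨ List.length-take (length τ) (a ∷ σ) ⟩
      length τ ℕ.⊓ suc (length σ)      ≤⟨ ℕ.m⊓n≤n (length τ) (suc (length σ)) ⟩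
      suc (length σ)                   <⟨ s≤s n<l ⟩
      suc (suc (length τ′))            ≡⟨ cong suc (ℕ.+-comm 1 (length τ′)) ⟩
      suc (length τ′ ℕ.+ 1)            ≡⟨ cong suc (List.length-++ τ′) ⟨
      length τ                         ∎)
      where open ℕ.≤-Reasoning

  -- If `u` fits below `a` and a < b, then all of `u` is below `b`, so `occ-skip` discards `u` from
  -- the count; otherwise both sides vanish. The right side separates `u` from `b` and `ρ`.
  summand-split : ∀ a u b ρ s → length u ≡ length τ′ →
    ind (occursAt a (u ++ b ∷ ρ)) ℤ.* δ (occ τ (u ++ b ∷ ρ)) s ≡
    ind (fits a u) ℤ.* (ind (a <ᵇ b) ℤ.* δ (occ τ (b ∷ ρ)) s)
  summand-split a u b ρ s len rewrite orderIso-take-τ a b u ρ len with T? (fits a u) | T? (a <ᵇ b)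
  ... | no ¬p | _ rewrite ¬T⇒≡false ¬p = refl
  ... | yes p | no ¬q rewrite T⇒≡true p | ¬T⇒≡false ¬q = refl
  ... | yes p | yes q rewrite T⇒≡true p | T⇒≡true q
    | occ-skip u b ρ (ℕ.≤-reflexive len) (λ i → ℕ.<-trans (proj₂ (fits⁻ {a} {u} p) i) (ℕ.<ᵇ⇒< a b q))
    = sym (ℤ.*-identityˡ _)

  count-fits : ∀ {i} → i < k → sumOver (words k (length τ′)) (ind ∘ fits (suc i)) ≡ + (i C m)
  count-fits {i} i<k = trans (sym (length-filter (T? ∘ below i) (words k (length τ′))))
    (cong +_ (count-orderIso (ℕ.<⇒≤ i<k)))

  -- A word of this length is `u ++ b ∷ ρ` with `u` as long as `τ′`. The summand being a product,
  -- the sum over `u` counts the fitting interiors and the sum over `b` and `ρ` is `startingAbove`.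
  afterOccurrence-long : ∀ {i} → i < k → ∀ n s →
    afterOccurrence (suc i) (gap ℕ.+ n) s ≡ + (i C m) ℤ.* startingAbove (suc i) n s
  afterOccurrence-long {i} i<k n s = begin
    sumOver (words k (gap ℕ.+ n)) h
      ≡⟨ cong (λ N → sumOver (words k N) h) (ℕ.+-suc (length τ′) n) ⟨
    sumOver (words k (length τ′ ℕ.+ suc n)) h
      ≡⟨ sumOver-words-+ k (length τ′) (suc n) h ⟩
    sumOver (words k (length τ′)) (λ u → sumOver (words k (suc n)) (λ v → h (u ++ v)))
      ≡⟨ sumOver-cong-∈ (words k (length τ′)) (λ {u} i → inner-sum u (proj₁ (∈-words⁻ (length τ′) i))) ⟩
    sumOver (words k (length τ′)) (λ u → ind (fits a u) ℤ.* startingAbove a n s)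
      ≡⟨ sumOver-*ʳ (words k (length τ′)) (ind ∘ fits a) (startingAbove a n s) ⟩
    sumOver (words k (length τ′)) (ind ∘ fits a) ℤ.* startingAbove a n s
      ≡⟨ cong (ℤ._* startingAbove a n s) (count-fits i<k) ⟩
    + (i C m) ℤ.* startingAbove a n s ∎
    where
    open ≡-Reasoning
    a : ℕ
    a = suc i
    h : List ℕ → ℤ
    h σ = ind (occursAt a σ) ℤ.* δ (occ τ σ) s
    inner-sum : ∀ u → length u ≡ length τ′ →
      sumOver (words k (suc n)) (λ v → h (u ++ v)) ≡ ind (fits a u) ℤ.* startingAbove a n s
    inner-sum u len = begin
      sumOver (words k (suc n)) (λ v → h (u ++ v))
        ≡⟨ sumOver-words-suc k n (λ v → h (u ++ v)) ⟩
      sumOver (letters k) (λ b → sumOver (words k n) (λ ρ → h (u ++ b ∷ ρ)))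
        ≡⟨ sumOver-cong (letters k) (λ b → begin
             sumOver (words k n) (λ ρ → h (u ++ b ∷ ρ))
               ≡⟨ sumOver-cong (words k n) (λ ρ → summand-split a u b ρ s len) ⟩
             sumOver (words k n) (λ ρ → ind (fits a u) ℤ.* (ind (a <ᵇ b) ℤ.* δ (occ τ (b ∷ ρ)) s))
               ≡⟨ sumOver-*ˡ (words k n) (ind (fits a u)) (λ ρ → ind (a <ᵇ b) ℤ.* δ (occ τ (b ∷ ρ)) s) ⟩
             ind (fits a u) ℤ.* sumOver (words k n) (λ ρ → ind (a <ᵇ b) ℤ.* δ (occ τ (b ∷ ρ)) s)
               ≡⟨ cong (ℤ._*_ (ind (fits a u))) (sumOver-*ˡ (words k n) (ind (a <ᵇ b)) (λ ρ → δ (occ τ (b ∷ ρ)) s)) ⟩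
             ind (fits a u) ℤ.* (ind (a <ᵇ b) ℤ.* startingWith b n s) ∎) ⟩
      sumOver (letters k) (λ b → ind (fits a u) ℤ.* (ind (a <ᵇ b) ℤ.* startingWith b n s))
        ≡⟨ sumOver-*ˡ (letters k) (ind (fits a u)) (λ b → ind (a <ᵇ b) ℤ.* startingWith b n s) ⟩
      ind (fits a u) ℤ.* startingAbove a n s ∎

  afterOccurrence-product : ∀ {i} → i < k →
    afterOccurrence (suc i) ≈ powPS X gap ⊗ (constPS (+ (i C m)) ⊗ startingAbove (suc i))
  afterOccurrence-product {i} i<k n s with n ℕ.<? gap
  ... | yes n<l = trans (afterOccurrence-short (suc i) s n<l) (sym (powX-⊗-< gap (constPS (+ (i C m)) ⊗ startingAbove (suc i)) s n<l))
  ... | no  n≮l = subst (λ N → afterOccurrence (suc i) N s ≡ (powPS X gap ⊗ rest) N s)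
    (ℕ.m+[n∸m]≡n (ℕ.≮⇒≥ n≮l)) (begin
      afterOccurrence (suc i) (gap ℕ.+ d) s        ≡⟨ afterOccurrence-long i<k d s ⟩
      + (i C m) ℤ.* startingAbove (suc i) d s                  ≡⟨ constPS-⊗ (+ (i C m)) (startingAbove (suc i)) d s ⟨
      rest d s                                                 ≡⟨ powX-⊗-+ gap rest d s ⟨
      (powPS X gap ⊗ rest) (gap ℕ.+ d) s ∎)
    where
    open ≡-Reasoning
    d : ℕ
    d = n ∸ gap
    rest : PS
    rest = constPS (+ (i C m)) ⊗ startingAbove (suc i)

  recurrence : ∀ {i} → i < k →
    startingAbove i ≈ F ⊕ factor (i C m) gap ⊗ startingAbove (suc i)
  recurrence {i} i<k = begin
    startingAbove i
      ≈⟨ startingAbove-suc i<k ⟩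
    startingWith (suc i) ⊕ t
      ≈⟨ +-congʳ {t} (startingWith-split (suc i)) ⟩
    F ⊖ e ⊗ afterOccurrence (suc i) ⊕ t
      ≈⟨ +-congʳ {t} (+-congˡ {F} (neg-cong (*-congˡ {e} (afterOccurrence-product i<k)))) ⟩
    F ⊖ e ⊗ (p ⊗ (constPS (+ (i C m)) ⊗ t)) ⊕ t
      ≈⟨ step F e p (constPS (+ (i C m))) t ⟩
    F ⊕ factor (i C m) gap ⊗ t ∎
    where
    open SetoidReasoning setoid
    e p t : PS
    e = onePS ⊖ Y
    p = powPS X gap
    t = startingAbove (suc i)

  q : ℕ → PS
  q j = factor (j C m) gap

  startingAbove-zero : suc m ≤ k → startingAbove 0 ≈ F ⊗ (constPS (+ m) ⊕ tailSum m gap (suc (k ∸ suc m)))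
  startingAbove-zero m<k = begin
    startingAbove 0
      ≈⟨ linear-recurrence k {F} {q} {startingAbove} recurrence startingAbove-all ⟩
    F ⊗ sumPS k (λ b → prodPS b q)
      -- The k terms are the m trivial ones and k - m further ones; writing the latter number as
      -- `suc (k ∸ suc m)` matches the range of the outer sum in `denom`.
      ≡⟨ cong (λ N → F ⊗ sumPS N (λ b → prodPS b q)) (trans (ℕ.+-suc m (k ∸ suc m)) (ℕ.m+[n∸m]≡n m<k)) ⟨
    F ⊗ sumPS (m ℕ.+ suc (k ∸ suc m)) (λ b → prodPS b q)
      ≈⟨ *-congˡ {F} (reindex m (suc (k ∸ suc m)) gap) ⟩
    F ⊗ (constPS (+ m) ⊕ tailSum m gap (suc (k ∸ suc m))) ∎
    where
    open SetoidReasoning setoid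

  F-inverse : ∀ {l} → l ≡ suc gap → suc m ≤ k →
    Fτ (suc m ∷ τ′ ++ suc (suc m) ∷ []) k ⊗ denom (suc m) l k ≈ onePS
  F-inverse refl m<k = inverse-denom {Fτ (suc m ∷ τ′ ++ suc (suc m) ∷ []) k} {startingAbove 0} m gap k
    F-by-first-letter (startingAbove-zero m<k)

theorem2p11 : (m l k : ℕ) (τ′ : List ℕ) → 1 ≤ m →
    IsSubwordPattern (suc m) l (m ∷ τ′ ++ suc m ∷ []) →
    m ∉ τ′ → suc m ∉ τ′ → m ≤ k →
    (n s : ℕ) → (Fτ (m ∷ τ′ ++ suc m ∷ []) k ⊗ denom m l k) n s ≡ onePS n s
theorem2p11 (suc m) l k τ′ _ (length≡l , range , surj) m∉ m+1∉ m≤k =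
  Recurrence.F-inverse m τ′ letter-range all-letters k
    (trans (sym length≡l) (cong suc (trans (List.length-++ τ′) (ℕ.+-comm (length τ′) 1)))) m≤k
  where
  letter-range : ∀ {c} → c ∈ τ′ → 1 ≤ c × c ≤ m
  -- The two largest letters of the pattern are excluded from `τ′` one after the other, each
  -- lowering the upper bound by one.
  letter-range {c} i = proj₁ c-range , ℕ.≤-pred (ℕ.≤∧≢⇒< (ℕ.≤-pred (ℕ.≤∧≢⇒< (proj₂ c-range) λ { refl → m+1∉ i })) λ { refl → m∉ i })
    where
    c-range : 1 ≤ c × c ≤ suc (suc m)
    c-range = range c (there (∈-++⁺ˡ i))
  all-letters : ∀ {c} → 1 ≤ c → c ≤ m → c ∈ τ′
  -- The pattern contains `c`, and `c` is too small to be its first or last letter.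
  all-letters {c} 1≤c c≤m with surj c 1≤c (ℕ.m≤n⇒m≤1+n (ℕ.m≤n⇒m≤1+n c≤m))
  ... | here refl = ⊥-elim (ℕ.1+n≰n c≤m)
  ... | there i with ∈-++⁻ τ′ i
  ...   | inj₁ j           = j
  ...   | inj₂ (here refl) = ⊥-elim (ℕ.1+n≰n (ℕ.<⇒≤ c≤m))
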